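{- Let $p$ be a prime greater than $3$ and let $t\in D_p$. Then modulo $p$: \begin{align*} \sum_{k=0}^{\lfloor p/6\rfloor}S_k t^k&\equiv \frac{3}{4}\left(\frac{p}{3}\right) w_{\lfloor p/6\rfloor}(1-216t),\\ \sum_{k=(p-1)/2}^{\lfloor 5p/6\rfloor}S_kt^k&\equiv -\frac{1}{8}\left(\frac{p}{3}\right)\Bigl(w_{\lfloor 5p/6\rfloor}(1-216t)+w_{\lfloor p/6\rfloor}(1-216t)\Bigr),\\ \sum_{k=0}^{\lfloor p/6\rfloor}(2k+1)S_kt^k&\equiv \frac{1}{2}(-1)^{\frac{p-1}{2}} w_{\lfloor p/6\rfloor}(216t-1),\\ \sum_{k=(p+1)/2}^{\lfloor 5p/6\rfloor}(2k+1)S_kt^k&\equiv \frac{1}{12}(-1)^{\frac{p-1}{2}} \Bigl(w_{\lfloor 5p/6\rfloor}(216t-1)-w_{\lfloor p/6\rfloor}(216t-1)\Bigr). \end{align*}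
   Context: $S_n=\frac{\binom{6n}{3n}\binom{3n}{n}}{2\binom{2n}{n}(2n+1)}$ for $n\ge 0$. The polynomials $w_n(x)$ are defined by $w_0(x)=1$, $w_1(x)=1+2x$, $w_{n+1}(x)=2xw_n(x)-w_{n-1}(x)$. $D_p$ is the set of rationals whose denominator is not divisible by $p$; congruences are in the usual sense. $\left(\frac{p}{3}\right)$ is the Legendre symbol. -}

module Defs where

open import Data.Nat as ℕ using (ℕ; zero; suc; _≤_; z≤n; s≤s; _<_; NonZero)
open import Data.Nat.Properties using (≤-trans; m≤m+n; m*n≢0; +-comm)
open import Data.Nat.Combinatorics using (_C_; nCk+nC[k+1]≡[n+1]C[k+1])
open import Data.Nat.Divisibility using (_∣_)
open import Data.Nat.DivMod using (_%_)
open import Data.Integer as ℤ using (ℤ; +_)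
open import Data.Rational as ℚ using (ℚ; _+_; _*_; _-_; -_; 0ℚ; 1ℚ; ↧ₙ_)
open import Data.Product using (Σ; _×_)
open import Relation.Nullary using (¬_)
open import Relation.Binary.PropositionalEquality using (_≡_; refl; subst)

nCk>0 : ∀ n k → k ≤ n → 0 < n C k
nCk>0 zero .zero z≤n = s≤s z≤n
nCk>0 (suc n) zero z≤n = s≤s z≤n
nCk>0 (suc n) (suc k) (s≤s k≤n) =
  subst (0 <_) (nCk+nC[k+1]≡[n+1]C[k+1] n k)
        (≤-trans (nCk>0 n k k≤n) (m≤m+n (n C k) (n C suc k)))

Sden : ℕ → ℕ
Sden n = 2 ℕ.* ((2 ℕ.* n) C n) ℕ.* (2 ℕ.* n ℕ.+ 1)

Sden-nz : ∀ n → NonZero (Sden n)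
Sden-nz n = m*n≢0 (2 ℕ.* ((2 ℕ.* n) C n)) (2 ℕ.* n ℕ.+ 1)
  {{m*n≢0 2 ((2 ℕ.* n) C n) {{_}} {{ℕ.>-nonZero (nCk>0 (2 ℕ.* n) n (m≤m+n n (n ℕ.+ 0)))}}}}
  {{subst NonZero (+-comm 1 (2 ℕ.* n)) _}}

S : ℕ → ℚ
S n = ((+ (((6 ℕ.* n) C (3 ℕ.* n)) ℕ.* ((3 ℕ.* n) C n))) ℚ./ Sden n) {{Sden-nz n}}

ℚof : ℕ → ℚ
ℚof n = + n ℚ./ 1

frac : ℤ → (d : ℕ) → .{{NonZero d}} → ℚ
frac z d = z ℚ./ d

infixr 8 _^_
_^_ : ℚ → ℕ → ℚ
x ^ zero = 1ℚ
x ^ suc k = x * (x ^ k)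

w : ℕ → ℚ → ℚ
w zero x = 1ℚ
w (suc zero) x = 1ℚ + ℚof 2 * x
w (suc (suc n)) x = ℚof 2 * x * w (suc n) x - w n x

-- Σ_{k=a}^{b} f k  (empty if b < a)
sumUpTo : ℕ → (ℕ → ℚ) → ℚ
sumUpTo zero f = 0ℚ
sumUpTo (suc m) f = sumUpTo m f + f m

Σ[_,_] : ℕ → ℕ → (ℕ → ℚ) → ℚ
Σ[ a , b ] f = sumUpTo (suc b ℕ.∸ a) (λ i → f (a ℕ.+ i))

-- Legendre symbol (p/3): quadratic residues mod 3 are {1}
legendre3-rem : ℕ → ℚ
legendre3-rem zero = 0ℚ
legendre3-rem (suc zero) = 1ℚ
legendre3-rem (suc (suc _)) = - 1ℚ

legendre3 : ℕ → ℚ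
legendre3 p = legendre3-rem (p % 3)

InD : ℕ → ℚ → Set
InD p x = ¬ (p ∣ ↧ₙ x)

infix 4 _≡_[mod_]
_≡_[mod_] : ℚ → ℚ → ℕ → Set
a ≡ b [mod p ] = Σ ℚ (λ c → InD p c × (a - b ≡ ℚof p * c))

{-# OPTIONS --safe #-}
module Submission where

-- The generating functions of S k and (2k + 1) S k are hypergeometric, with term ratios
-- 6 (6k + 1)(6k + 5) / ((k + 1)(2k + d)) for d = 3 and d = 1. The coefficients of t ^ k in
-- w N (1 - 216 t) and w N (216 t - 1) have term ratios 216 (k - N)(k + N + 1) / ((k + 1)(2k + d)),
-- and modulo p these agree with the former for N = n = ⌊p/6⌋ and for N = m = ⌊5p/6⌋ = p - 1 - n.
-- For k ≤ n all factors are units, so comparing the initial terms gives the sums up to n.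
-- At k = n the numerator acquires exactly one factor p, which the denominator 2k + d cancels at
-- the index q where 2q + d = p. Dividing by p in between shows that the terms vanish modulo p for
-- n < k ≤ q and are proportional again for q < k ≤ m, with constant multiplied by 1/6; the
-- coefficients of w m with k ≤ n, which are ± those of w n, have to be subtracted.

open import Defs
open import Data.Nat as ℕ using (ℕ; zero; suc; NonZero; _!; _≤_; _<_; s≤s; z≤n; _∸_)
open import Data.Nat.Combinatorics using (_C_; nCk≡n!/k![n-k]!; k![n∸k]!∣n!)
import Data.Nat.Coprimality as Coprimality
open import Data.Nat.DivMod using (_/_; _%_; +-distrib-/-∣ʳ; m/n*n≡m; m<n⇒m/n≡0; m*n/n≡m; [m+kn]%n≡m%n; m≡m%n+[m/n]*n; m%n<n)
open import Data.Nat.Divisibility using (_∣_; divides; divides-refl; >⇒∤; ∣-refl; ∣-trans; ∣1⇒≡1; ∣m+n∣m⇒∣n)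
open import Data.Nat.Primality using (Prime; euclidsLemma; prime⇒irreducible; prime⇒nonZero; ¬prime[1])
import Data.Nat.Properties as ℕₚ
open import Data.Nat.Solver renaming (module +-*-Solver to ℕ-Solver)
open import Data.Integer as ℤ using (ℤ; +_)
import Data.Integer.Properties as ℤₚ
open import Data.Rational as ℚ using (ℚ; mkℚ; _+_; _*_; _-_; -_; 0ℚ; 1ℚ; ↥_; ↧ₙ_; toℚᵘ)
import Data.Rational.Properties as ℚₚ
open import Data.Rational.Solver using (module +-*-Solver)
open import Data.Rational.Unnormalised as ℚᵘ using (mkℚᵘ; *≡*)
import Data.Rational.Unnormalised.Properties as ℚᵘₚ
open import Data.Product using (_×_; _,_; ∃)
open import Data.Sum using (_⊎_; inj₁; inj₂; [_,_]′)
open import Function using (_$_)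
open import Relation.Nullary using (¬_; yes; no; contradiction)
open import Relation.Binary.PropositionalEquality using (_≡_; refl; sym; trans; cong; cong₂; subst; subst₂; module ≡-Reasoning)

-- The embeddings of ℤ and ℕ into ℚ

-- The `w N` are the Chebyshev polynomials of the fourth kind: with Gauss's F they equal
-- `(2N + 1) F(-N, N + 1; 3/2; (1 - x)/2)` and `(-1)^N F(-N, N + 1; 1/2; (1 + x)/2)`, so
-- `x = 1 - 216 t` and `x = 216 t - 1` make the argument `108 t`. The ratios agree because `6 (6k +
-- 1)(6k + 5) - 216 (k - N)(k + N + 1)` is `6 (6N + 1)(6N + 5)`, free of `k`. For `N =
-- n` one of these factors is `p`, and `N (N + 1)` has the same residue for `N =
-- m`. The coefficients of `w n` stop at `n`, so beyond the zero of the ratios only `w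
-- m` can be compared with `S
-- k`. At that zero a congruence modulo `p` is worthless after division by `p`; the constant `1/6`
-- comes from knowing both numerators exactly, as `p · 6r` and `p · 216 (n - m)`, where `r` is the
-- other factor of `(6n + 1)(6n + 5)`. Recurrences are stated without division, because their
-- denominator is not a unit at `q`.

toℚᵘ-/ : ∀ i d .{{_ : NonZero d}} → toℚᵘ (i ℚ./ d) ℚᵘ.≃ i ℚᵘ./ d
toℚᵘ-/ i (suc d-1) = ℚₚ.toℚᵘ-fromℚᵘ (mkℚᵘ i d-1)

fromℤ : ℤ → ℚ
fromℤ i = i ℚ./ 1

fromℤ-+ : ∀ i j → fromℤ (i ℤ.+ j) ≡ fromℤ i + fromℤ j
fromℤ-+ i j = ℚₚ.toℚᵘ-injective (begin
  toℚᵘ (fromℤ (i ℤ.+ j))                 ≈⟨ toℚᵘ-/ (i ℤ.+ j) 1 ⟩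
  mkℚᵘ (i ℤ.+ j) 0
    ≈⟨ *≡* (cong₂ (λ x y → (x ℤ.+ y) ℤ.* + 1) (sym (ℤₚ.*-identityʳ i)) (sym (ℤₚ.*-identityʳ j))) ⟩
  mkℚᵘ i 0 ℚᵘ.+ mkℚᵘ j 0                 ≈⟨ ℚᵘₚ.+-cong (toℚᵘ-/ i 1) (toℚᵘ-/ j 1) ⟨
  toℚᵘ (fromℤ i) ℚᵘ.+ toℚᵘ (fromℤ j)     ≈⟨ ℚₚ.toℚᵘ-homo-+ (fromℤ i) (fromℤ j) ⟨
  toℚᵘ (fromℤ i + fromℤ j)               ∎)
  where open ℚᵘₚ.≃-Reasoning

fromℤ-* : ∀ i j → fromℤ (i ℤ.* j) ≡ fromℤ i * fromℤ j
fromℤ-* i j = ℚₚ.toℚᵘ-injective (begin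
  toℚᵘ (fromℤ (i ℤ.* j))                 ≈⟨ toℚᵘ-/ (i ℤ.* j) 1 ⟩
  mkℚᵘ i 0 ℚᵘ.* mkℚᵘ j 0                 ≈⟨ ℚᵘₚ.*-cong (toℚᵘ-/ i 1) (toℚᵘ-/ j 1) ⟨
  toℚᵘ (fromℤ i) ℚᵘ.* toℚᵘ (fromℤ j)     ≈⟨ ℚₚ.toℚᵘ-homo-* (fromℤ i) (fromℤ j) ⟨
  toℚᵘ (fromℤ i * fromℤ j)               ∎)
  where open ℚᵘₚ.≃-Reasoning

d*[i/d]≡i : ∀ i d .{{_ : NonZero d}} → ℚof d * (i ℚ./ d) ≡ fromℤ i
d*[i/d]≡i i d@(suc _) = ℚₚ.toℚᵘ-injective (begin
  toℚᵘ (ℚof d * (i ℚ./ d))              ≈⟨ ℚₚ.toℚᵘ-homo-* (ℚof d) (i ℚ./ d) ⟩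
  toℚᵘ (ℚof d) ℚᵘ.* toℚᵘ (i ℚ./ d)      ≈⟨ ℚᵘₚ.*-cong (toℚᵘ-/ (+ d) 1) (toℚᵘ-/ i d) ⟩
  mkℚᵘ (+ d) 0 ℚᵘ.* (i ℚᵘ./ d)
    ≈⟨ *≡* (trans (ℤₚ.*-identityʳ (+ d ℤ.* i)) (trans (ℤₚ.*-comm (+ d) i) (cong (λ e → i ℤ.* + e) (sym (ℕₚ.*-identityˡ d))))) ⟩
  mkℚᵘ i 0                              ≈⟨ toℚᵘ-/ i 1 ⟨
  toℚᵘ (fromℤ i)                        ∎)
  where open ℚᵘₚ.≃-Reasoning

open ≡-Reasoning

-- Natural numbers

-- Indexing by the two parts `a` and `b` keeps truncated subtraction out of the later factorial
-- identities.
C-! : ∀ a b → ((a ℕ.+ b) C a) ℕ.* (a ! ℕ.* b !) ≡ (a ℕ.+ b) !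
C-! a b = begin
  ((a ℕ.+ b) C a) ℕ.* (a ! ℕ.* b !)
    ≡⟨ cong (λ c → ((a ℕ.+ b) C a) ℕ.* (a ! ℕ.* c !)) (ℕₚ.m+n∸m≡n a b) ⟨
  ((a ℕ.+ b) C a) ℕ.* (a ! ℕ.* (a ℕ.+ b ℕ.∸ a) !)
    ≡⟨ cong (ℕ._* (a ! ℕ.* (a ℕ.+ b ℕ.∸ a) !)) (nCk≡n!/k![n-k]! a≤a+b) ⟩
  ((a ℕ.+ b) ! ℕ./ (a ! ℕ.* (a ℕ.+ b ℕ.∸ a) !)) ℕ.* (a ! ℕ.* (a ℕ.+ b ℕ.∸ a) !)
    ≡⟨ m/n*n≡m (k![n∸k]!∣n! a≤a+b) ⟩
  (a ℕ.+ b) ! ∎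
  where
  a≤a+b : a ≤ a ℕ.+ b
  a≤a+b = ℕₚ.m≤m+n a b
  instance
    _ : NonZero (a ! ℕ.* (a ℕ.+ b ℕ.∸ a) !)
    _ = a ℕₚ.!* (a ℕ.+ b ℕ.∸ a) !≢0

Snum : ℕ → ℕ
Snum k = ((6 ℕ.* k) C (3 ℕ.* k)) ℕ.* ((3 ℕ.* k) C k)

-- The central binomial is left standing on the right because `Sden k` contains it too; `S-!`
-- cancels it.
Snum-! : ∀ k → Snum k ℕ.* ((3 ℕ.* k) ! ℕ.* ((2 ℕ.* k) ! ℕ.* (2 ℕ.* k) !))
             ≡ ((2 ℕ.* k) C k) ℕ.* ((6 ℕ.* k) ! ℕ.* k !)
Snum-! k = begin
  P ℕ.* Q ℕ.* (X ℕ.* (Y ℕ.* Y))                 ≡⟨ cong (λ y → P ℕ.* Q ℕ.* (X ℕ.* (Y ℕ.* y))) eqR ⟨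
  P ℕ.* Q ℕ.* (X ℕ.* (Y ℕ.* (R ℕ.* (K ℕ.* K))))
    ≡⟨ solve 6 (λ P Q R X Y K → P :* Q :* (X :* (Y :* (R :* (K :* K))))
        := R :* (P :* (X :* (Q :* (K :* Y))) :* K)) refl P Q R X Y K ⟩
  R ℕ.* (P ℕ.* (X ℕ.* (Q ℕ.* (K ℕ.* Y))) ℕ.* K)   ≡⟨ cong (λ x → R ℕ.* (P ℕ.* (X ℕ.* x) ℕ.* K)) eqQ ⟩
  R ℕ.* (P ℕ.* (X ℕ.* X) ℕ.* K)                   ≡⟨ cong (λ z → R ℕ.* (z ℕ.* K)) eqP ⟩
  R ℕ.* ((6 ℕ.* k) ! ℕ.* K) ∎
  where
  open ℕ-Solver
  P Q R X Y K : ℕ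
  P = (6 ℕ.* k) C (3 ℕ.* k)
  Q = (3 ℕ.* k) C k
  R = (2 ℕ.* k) C k
  X = (3 ℕ.* k) !
  Y = (2 ℕ.* k) !
  K = k !
  eqR : R ℕ.* (K ℕ.* K) ≡ Y
  eqR = subst (λ n → (n C k) ℕ.* (K ℕ.* K) ≡ n !) (solve 1 (λ k → k :+ k := con 2 :* k) refl k) (C-! k k)
  eqQ : Q ℕ.* (K ℕ.* Y) ≡ X
  eqQ = C-! k (2 ℕ.* k)
  eqP : P ℕ.* (X ℕ.* X) ≡ (6 ℕ.* k) !
  eqP = subst (λ n → (n C (3 ℕ.* k)) ℕ.* (X ℕ.* X) ≡ n !) (solve 1 (λ k → con 3 :* k :+ con 3 :* k
      := con 6 :* k) refl k) (C-! (3 ℕ.* k) (3 ℕ.* k))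

odd-split : ∀ d q i → q ≤ i → suc (d ℕ.+ 2 ℕ.* q) ℕ.+ 2 ℕ.* (i ∸ q) ≡ suc (d ℕ.+ 2 ℕ.* i)
odd-split d q i q≤i = trans
  (solve 3 (λ d q j → con 1 :+ (d :+ con 2 :* q) :+ con 2 :* j := con 1 :+ (d :+ con 2 :* (q :+ j))) refl d q (i ∸ q))
  (cong (λ j → suc (d ℕ.+ 2 ℕ.* j)) (ℕₚ.m+[n∸m]≡n q≤i))
  where open ℕ-Solver

/-unique : ∀ {x} r q d .{{_ : NonZero d}} → r < d → x ≡ r ℕ.+ q ℕ.* d → x / d ≡ q
/-unique r q d r<d refl = trans (+-distrib-/-∣ʳ r (divides-refl q)) (cong₂ ℕ._+_ (m<n⇒m/n≡0 r<d) (m*n/n≡m q d))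

module ℕ-Identities where
  open ℕ-Solver

  -- Writing the class of 1 as `7 + 6n`, with `⌊p/6⌋ = suc n`, makes `q = (p - 3)/2 = 2 + 3n` free
  -- of subtraction.
  7+6n-identities : ∀ n → let p = 7 ℕ.+ n ℕ.* 6 in
      suc (suc n ℕ.+ (5 ℕ.+ 5 ℕ.* n)) ≡ p
    × suc (2 ℕ.+ 2 ℕ.* (2 ℕ.+ 3 ℕ.* n)) ≡ p
    × 5 ℕ.* p ≡ 5 ℕ.+ (5 ℕ.+ 5 ℕ.* n) ℕ.* 6
    × p ∸ 1 ≡ 0 ℕ.+ (3 ℕ.+ 3 ℕ.* n) ℕ.* 2
    × p ℕ.+ 1 ≡ 0 ℕ.+ (4 ℕ.+ 3 ℕ.* n) ℕ.* 2
    × p ≡ 1 ℕ.+ (2 ℕ.+ 2 ℕ.* n) ℕ.* 3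
  7+6n-identities n =
      solve 1 (λ n → con 1 :+ (con 1 :+ n :+ (con 5 :+ con 5 :* n)) := con 7 :+ n :* con 6) refl n
    , solve 1 (λ n → con 1 :+ (con 2 :+ con 2 :* (con 2 :+ con 3 :* n)) := con 7 :+ n :* con 6) refl n
    , solve 1 (λ n → con 5 :* (con 7 :+ n :* con 6) := con 5 :+ (con 5 :+ con 5 :* n) :* con 6) refl n
    , solve 1 (λ n → con 6 :+ n :* con 6 := (con 3 :+ con 3 :* n) :* con 2) refl n
    , solve 1 (λ n → con 7 :+ n :* con 6 :+ con 1 := (con 4 :+ con 3 :* n) :* con 2) refl n
    , solve 1 (λ n → con 7 :+ n :* con 6 := con 1 :+ (con 2 :+ con 2 :* n) :* con 3) refl n

  5+6n-identities : ∀ n → let p = 5 ℕ.+ n ℕ.* 6 in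
      suc (n ℕ.+ (4 ℕ.+ 5 ℕ.* n)) ≡ p
    × suc (2 ℕ.+ 2 ℕ.* (1 ℕ.+ 3 ℕ.* n)) ≡ p
    × 5 ℕ.* p ≡ 1 ℕ.+ (4 ℕ.+ 5 ℕ.* n) ℕ.* 6
    × p ∸ 1 ≡ 0 ℕ.+ (2 ℕ.+ 3 ℕ.* n) ℕ.* 2
    × p ℕ.+ 1 ≡ 0 ℕ.+ (3 ℕ.+ 3 ℕ.* n) ℕ.* 2
    × p ≡ 2 ℕ.+ (1 ℕ.+ 2 ℕ.* n) ℕ.* 3
  5+6n-identities n =
      solve 1 (λ n → con 1 :+ (n :+ (con 4 :+ con 5 :* n)) := con 5 :+ n :* con 6) refl n
    , solve 1 (λ n → con 1 :+ (con 2 :+ con 2 :* (con 1 :+ con 3 :* n)) := con 5 :+ n :* con 6) refl n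
    , solve 1 (λ n → con 5 :* (con 5 :+ n :* con 6) := con 1 :+ (con 4 :+ con 5 :* n) :* con 6) refl n
    , solve 1 (λ n → con 4 :+ n :* con 6 := (con 2 :+ con 3 :* n) :* con 2) refl n
    , solve 1 (λ n → con 5 :+ n :* con 6 :+ con 1 := (con 3 :+ con 3 :* n) :* con 2) refl n
    , solve 1 (λ n → con 5 :+ n :* con 6 := con 2 :+ (con 1 :+ con 2 :* n) :* con 3) refl n

  -- The form `j + j + l` feeds `sign-even`: `(p - 1)/2` and `⌊5p/6⌋` both have the parity of
  -- `⌊p/6⌋`.
  sign-exponents : ∀ n →
      (3 ℕ.+ 3 ℕ.* n ≡ suc n ℕ.+ suc n ℕ.+ suc n)
    × (5 ℕ.+ 5 ℕ.* n ≡ (2 ℕ.+ 2 ℕ.* n) ℕ.+ (2 ℕ.+ 2 ℕ.* n) ℕ.+ suc n)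
    × (2 ℕ.+ 3 ℕ.* n ≡ suc n ℕ.+ suc n ℕ.+ n)
    × (4 ℕ.+ 5 ℕ.* n ≡ (2 ℕ.+ 2 ℕ.* n) ℕ.+ (2 ℕ.+ 2 ℕ.* n) ℕ.+ n)
  sign-exponents n =
      solve 1 (λ n → con 3 :+ con 3 :* n := con 1 :+ n :+ (con 1 :+ n) :+ (con 1 :+ n)) refl n
    , solve 1 (λ n → con 5 :+ con 5 :* n := con 2 :+ con 2 :* n :+ (con 2 :+ con 2 :* n) :+ (con 1 :+ n)) refl n
    , solve 1 (λ n → con 2 :+ con 3 :* n := con 1 :+ n :+ (con 1 :+ n) :+ n) refl n
    , solve 1 (λ n → con 4 :+ con 5 :* n := con 2 :+ con 2 :* n :+ (con 2 :+ con 2 :* n) :+ n) refl n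

open ℕ-Identities

prime⇒∤ : ∀ {p} d → Prime p → 1 < d → d < p → ¬ d ∣ p
prime⇒∤ d pp 1<d d<p d∣p with prime⇒irreducible pp d∣p
... | inj₁ refl = ℕₚ.<-irrefl refl 1<d
... | inj₂ refl = ℕₚ.<-irrefl refl d<p

residue-cases : ∀ p → Prime p → 3 < p → ∀ r n → r < 6 → p ≡ r ℕ.+ n ℕ.* 6 →
  (∃ λ n → p ≡ 7 ℕ.+ n ℕ.* 6) ⊎ (∃ λ n → p ≡ 5 ℕ.+ n ℕ.* 6)
residue-cases p pp 3<p = go
  where
  open ℕ-Solver
  2∤p : ¬ 2 ∣ p
  2∤p = prime⇒∤ 2 pp (s≤s (s≤s z≤n)) (ℕₚ.<-trans (ℕₚ.n<1+n 2) 3<p)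
  3∤p : ¬ 3 ∣ p
  3∤p = prime⇒∤ 3 pp (s≤s (s≤s z≤n)) 3<p
  go : ∀ r n → r < 6 → p ≡ r ℕ.+ n ℕ.* 6 → (∃ λ n → p ≡ 7 ℕ.+ n ℕ.* 6) ⊎ (∃ λ n → p ≡ 5 ℕ.+ n ℕ.* 6)
  go 0 n _ e = contradiction (divides (n ℕ.* 3) (trans e (solve 1 (λ n → n :* con 6
      := n :* con 3 :* con 2) refl n))) 2∤p
  go 1 zero    _ refl = contradiction 3<p λ { (s≤s ()) }
  go 1 (suc n) _ e = inj₁ (n , e)
  go 2 n _ e = contradiction (divides (1 ℕ.+ n ℕ.* 3) (trans e (solve 1 (λ n → con 2 :+ n :* con 6
      := (con 1 :+ n :* con 3) :* con 2) refl n))) 2∤p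
  go 3 n _ e = contradiction (divides (1 ℕ.+ n ℕ.* 2) (trans e (solve 1 (λ n → con 3 :+ n :* con 6
      := (con 1 :+ n :* con 2) :* con 3) refl n))) 3∤p
  go 4 n _ e = contradiction (divides (2 ℕ.+ n ℕ.* 3) (trans e (solve 1 (λ n → con 4 :+ n :* con 6
      := (con 2 :+ n :* con 3) :* con 2) refl n))) 2∤p
  go 5 n _ e = inj₂ (n , e)
  go (suc (suc (suc (suc (suc (suc r)))))) n (s≤s (s≤s (s≤s (s≤s (s≤s (s≤s ())))))) e

open +-*-Solver

ℚof-* : ∀ a b → ℚof (a ℕ.* b) ≡ ℚof a * ℚof b
ℚof-* a b = trans (cong fromℤ (ℤₚ.pos-* a b)) (fromℤ-* (+ a) (+ b))

-- Opaque, since ℚof n with n a variable would unfold to a stuck gcd computation.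
opaque
  ι : ℕ → ℚ
  ι = ℚof

  ι≡ℚof : ∀ n → ι n ≡ ℚof n
  ι≡ℚof n = refl

  ι-zero : ι 0 ≡ 0ℚ
  ι-zero = refl

  ι-+ : ∀ a b → ι (a ℕ.+ b) ≡ ι a + ι b
  ι-+ a b = fromℤ-+ (+ a) (+ b)

  ι-* : ∀ a b → ι (a ℕ.* b) ≡ ι a * ι b
  ι-* = ℚof-*

  ι-suc : ∀ k → ι (suc k) ≡ ι k + 1ℚ
  ι-suc k = trans (ι-+ 1 k) (ℚₚ.+-comm 1ℚ (ι k))

  1/ι : ∀ d .{{_ : NonZero d}} → ℚ
  1/ι d = + 1 ℚ./ d

  ι*1/ι : ∀ d .{{_ : NonZero d}} → ι d * 1/ι d ≡ 1ℚ
  ι*1/ι d = d*[i/d]≡i (+ 1) d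

1/ι-cancel : ∀ d .{{_ : NonZero d}} x → 1/ι d * (ι d * x) ≡ x
1/ι-cancel d x = begin
  1/ι d * (ι d * x)   ≡⟨ solve 3 (λ d e x → e :* (d :* x) := d :* e :* x) refl (ι d) (1/ι d) x ⟩
  ι d * 1/ι d * x     ≡⟨ cong (_* x) (ι*1/ι d) ⟩
  1ℚ * x              ≡⟨ ℚₚ.*-identityˡ x ⟩
  x                   ∎

ι*[1/ι*x]≡x : ∀ d .{{_ : NonZero d}} x → ι d * (1/ι d * x) ≡ x
ι*[1/ι*x]≡x d x = trans (solve 3 (λ d e x → d :* (e :* x) := e :* (d :* x)) refl (ι d) (1/ι d) x) (1/ι-cancel d x)

ι-cancelˡ : ∀ d .{{_ : NonZero d}} {x y} → ι d * x ≡ ι d * y → x ≡ y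
ι-cancelˡ d {x} {y} eq = trans (sym (1/ι-cancel d x)) (trans (cong (1/ι d *_) eq) (1/ι-cancel d y))

↧ₙ*x≡↥ : ∀ x → ℚof (↧ₙ x) * x ≡ fromℤ (↥ x)
↧ₙ*x≡↥ x = trans (cong (ℚof (↧ₙ x) *_) (sym (ℚₚ.↥p/↧p≡p x))) (d*[i/d]≡i (↥ x) (↧ₙ x))

-- For the reduced fraction `a / b` the hypothesis gives `a d = z b`, and `b` is coprime to `a`.
-- Thus membership in D_p can be tested with any clearing multiplier prime to `p`, without reducing
-- fractions.
↧ₙ∣multiplier : ∀ d z x → ℚof d * x ≡ fromℤ z → ↧ₙ x ∣ d
↧ₙ∣multiplier d z x@(mkℚ a b-1 cop) eq = Coprimality.coprime-divisor (Coprimality.sym (Coprimality.recompute cop))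
  (divides ℤ.∣ z ∣ (begin
    ℤ.∣ a ∣ ℕ.* d                     ≡⟨ ℕₚ.*-comm ℤ.∣ a ∣ d ⟩
    d ℕ.* ℤ.∣ a ∣                     ≡⟨ ℤₚ.abs-* (+ d) a ⟨
    ℤ.∣ + d ℤ.* a ∣                   ≡⟨ cong ℤ.∣_∣ cross ⟩
    ℤ.∣ z ℤ.* + suc b-1 ∣             ≡⟨ ℤₚ.abs-* z (+ suc b-1) ⟩
    ℤ.∣ z ∣ ℕ.* suc b-1               ∎))
  where
  eqᵘ : mkℚᵘ (+ d) 0 ℚᵘ.* mkℚᵘ a b-1 ℚᵘ.≃ mkℚᵘ z 0
  eqᵘ = ℚᵘₚ.≃-trans (ℚᵘₚ.*-cong (ℚᵘₚ.≃-sym (toℚᵘ-/ (+ d) 1)) ℚᵘₚ.≃-refl)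
       (ℚᵘₚ.≃-trans (ℚᵘₚ.≃-sym (ℚₚ.toℚᵘ-homo-* (ℚof d) x))
       (ℚᵘₚ.≃-trans (ℚₚ.toℚᵘ-cong eq) (toℚᵘ-/ z 1)))
  cross : + d ℤ.* a ≡ z ℤ.* + suc b-1
  cross with eqᵘ
  ... | *≡* e = trans (sym (ℤₚ.*-identityʳ (+ d ℤ.* a)))
    (trans e (cong (λ e → z ℤ.* + e) (ℕₚ.*-identityˡ (suc b-1))))

-- The ring D_p and its ideal p D_p

module Localisation (p : ℕ) (pp : Prime p) where

  _⋆_ : ∀ {a b} → ¬ p ∣ a → ¬ p ∣ b → ¬ p ∣ a ℕ.* b
  _⋆_ {a} {b} p∤a p∤b p∣ab = [ p∤a , p∤b ]′ (euclidsLemma a b pp p∣ab)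

  1∤ : ¬ p ∣ 1
  1∤ p∣1 with ∣1⇒≡1 p∣1
  ... | refl = ¬prime[1] pp

  -- The wrapper makes `x` inferable: `InD p x` unfolds to a negation that mentions only the
  -- denominator of `x`.
  record D (x : ℚ) : Set where
    constructor mkD
    field inD : InD p x
  open D public

  D-by : ∀ {x} d → ¬ p ∣ d → ∀ z → ℚof d * x ≡ fromℤ z → D x
  D-by {x} d p∤d z eq = mkD λ p∣↧x → p∤d (∣-trans p∣↧x (↧ₙ∣multiplier d z x eq))

  D-ℤ : ∀ z → D (fromℤ z)
  D-ℤ z = D-by 1 1∤ z (ℚₚ.*-identityˡ (fromℤ z))

  opaque
    unfolding ι 1/ι

    D-ι : ∀ a → D (ι a)
    D-ι a = D-ℤ (+ a)

    D-1/ι : ∀ d .{{_ : NonZero d}} → ¬ p ∣ d → D (1/ι d)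
    D-1/ι d p∤d = D-by d p∤d (+ 1) (d*[i/d]≡i (+ 1) d)

  D-/ : ∀ i d .{{_ : NonZero d}} → ¬ p ∣ d → D (frac i d)
  D-/ i d p∤d = D-by d p∤d i (d*[i/d]≡i i d)

  D-+ : ∀ {x y} → D x → D y → D (x + y)
  D-+ {x} {y} Dx Dy = D-by (↧ₙ x ℕ.* ↧ₙ y) (inD Dx ⋆ inD Dy) (↥ x ℤ.* + ↧ₙ y ℤ.+ ↥ y ℤ.* + ↧ₙ x) (begin
    ℚof (↧ₙ x ℕ.* ↧ₙ y) * (x + y)                 ≡⟨ cong (_* (x + y)) (ℚof-* (↧ₙ x) (↧ₙ y)) ⟩
    ℚof (↧ₙ x) * ℚof (↧ₙ y) * (x + y)
      ≡⟨ solve 4 (λ u v x y → u :* v :* (x :+ y) := u :* x :* v :+ v :* y :* u) refl (ℚof (↧ₙ x)) (ℚof (↧ₙ y)) x y ⟩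
    ℚof (↧ₙ x) * x * ℚof (↧ₙ y) + ℚof (↧ₙ y) * y * ℚof (↧ₙ x)
      ≡⟨ cong₂ (λ a b → a * ℚof (↧ₙ y) + b * ℚof (↧ₙ x)) (↧ₙ*x≡↥ x) (↧ₙ*x≡↥ y) ⟩
    fromℤ (↥ x) * ℚof (↧ₙ y) + fromℤ (↥ y) * ℚof (↧ₙ x)
      ≡⟨ cong₂ _+_ (fromℤ-* (↥ x) (+ ↧ₙ y)) (fromℤ-* (↥ y) (+ ↧ₙ x)) ⟨
    fromℤ (↥ x ℤ.* + ↧ₙ y) + fromℤ (↥ y ℤ.* + ↧ₙ x)  ≡⟨ fromℤ-+ (↥ x ℤ.* + ↧ₙ y) (↥ y ℤ.* + ↧ₙ x) ⟨
    fromℤ (↥ x ℤ.* + ↧ₙ y ℤ.+ ↥ y ℤ.* + ↧ₙ x) ∎)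

  D-* : ∀ {x y} → D x → D y → D (x * y)
  D-* {x} {y} Dx Dy = D-by (↧ₙ x ℕ.* ↧ₙ y) (inD Dx ⋆ inD Dy) (↥ x ℤ.* ↥ y) (begin
    ℚof (↧ₙ x ℕ.* ↧ₙ y) * (x * y)                 ≡⟨ cong (_* (x * y)) (ℚof-* (↧ₙ x) (↧ₙ y)) ⟩
    ℚof (↧ₙ x) * ℚof (↧ₙ y) * (x * y)
      ≡⟨ solve 4 (λ u v x y → u :* v :* (x :* y) := u :* x :* (v :* y)) refl (ℚof (↧ₙ x)) (ℚof (↧ₙ y)) x y ⟩
    ℚof (↧ₙ x) * x * (ℚof (↧ₙ y) * y)
      ≡⟨ cong₂ _*_ (↧ₙ*x≡↥ x) (↧ₙ*x≡↥ y) ⟩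
    fromℤ (↥ x) * fromℤ (↥ y)                     ≡⟨ fromℤ-* (↥ x) (↥ y) ⟨
    fromℤ (↥ x ℤ.* ↥ y) ∎)

  D-neg : ∀ {x} → D x → D (- x)
  D-neg {x} Dx = subst D (solve 1 (λ x → con (- 1ℚ) :* x := :- x) refl x) (D-* (D-ℤ (ℤ.- + 1)) Dx)

  D-cancel : ∀ u .{{_ : NonZero u}} {x} → ¬ p ∣ u → D (ι u * x) → D x
  D-cancel u {x} p∤u Dux = subst D (1/ι-cancel u x) (D-* (D-1/ι u p∤u) Dux)

  record I (x : ℚ) : Set where
    constructor mkI
    field
      quotient  : ℚ
      quotientD : D quotient
      x≡p*q     : x ≡ ι p * quotient

  I-+ : ∀ {x y} → I x → I y → I (x + y)
  I-+ (mkI c Dc refl) (mkI d Dd refl) = mkI (c + d) (D-+ Dc Dd) $ sym (ℚₚ.*-distribˡ-+ (ι p) c d)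

  I-* : ∀ {x y} → D x → I y → I (x * y)
  I-* {x} Dx (mkI c Dc refl) = mkI (x * c) (D-* Dx Dc) $ solve 3 (λ p x c → x :* (p :* c)
      := p :* (x :* c)) refl (ι p) x c

  I-p : ∀ {x} → D x → I (ι p * x)
  I-p {x} Dx = mkI x Dx refl

  I-cancel : ∀ u .{{_ : NonZero u}} {x} → ¬ p ∣ u → I (ι u * x) → I x
  I-cancel u {x} p∤u Iux = subst I (1/ι-cancel u x) (I-* (D-1/ι u p∤u) Iux)

-- The coefficients of w_N

-- Denominators (k + 1)(2k + 1 + d) of the hypergeometric term ratios, with d = 2 for S k
-- and d = 0 for (2k + 1) S k.
den : ℕ → ℕ → ℕ
den d k = suc k ℕ.* suc (d ℕ.+ 2 ℕ.* k)

ι-den : ∀ d k → ι (den d k) ≡ (ι k + 1ℚ) * (ι d + ℚof 2 * ι k + 1ℚ)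
ι-den d k = begin
  ι (den d k)                                   ≡⟨ ι-* (suc k) (suc (d ℕ.+ 2 ℕ.* k)) ⟩
  ι (suc k) * ι (suc (d ℕ.+ 2 ℕ.* k))         ≡⟨ cong₂ _*_ (ι-suc k) (ι-suc (d ℕ.+ 2 ℕ.* k)) ⟩
  (ι k + 1ℚ) * (ι (d ℕ.+ 2 ℕ.* k) + 1ℚ)
    ≡⟨ cong (λ x → (ι k + 1ℚ) * (x + 1ℚ)) (trans (ι-+ d (2 ℕ.* k)) (cong (λ x → ι d + x) (trans (ι-* 2 k) (cong (_* ι k) (ι≡ℚof 2))))) ⟩
  (ι k + 1ℚ) * (ι d + ℚof 2 * ι k + 1ℚ)     ∎

-- This is `(x + k)! / (x - k)!` as a polynomial in `x`; the rational argument permits symbolic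
-- shifts of `x` by one.
h : ℚ → ℕ → ℚ
h x zero    = 1ℚ
h x (suc k) = h x k * ((x - ι k) * (x + ι k + 1ℚ))

-- Both sides are `(x + k + 2)! / (x - k)!`. With `h-down` it turns the values of `h` in three
-- neighbouring rows into multiples of the single value `h (x + 1ℚ) k`, so the row recurrences
-- become polynomial identities.
h-up : ∀ x k → h (x + 1ℚ) (suc k) ≡ h x k * ((x + ι k + 1ℚ) * (x + ι k + ℚof 2))
h-up x zero rewrite ι-zero = solve 1 (λ x → con 1ℚ :* ((x :+ con 1ℚ :- con 0ℚ) :* (x :+ con 1ℚ :+ con 0ℚ :+ con 1ℚ))
  := con 1ℚ :* ((x :+ con 0ℚ :+ con 1ℚ) :* (x :+ con 0ℚ :+ con (ℚof 2)))) refl x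
h-up x (suc k) rewrite h-up x k | ι-suc k =
  solve 3 (λ x k y → y :* ((x :+ k :+ con 1ℚ) :* (x :+ k :+ con (ℚof 2)))
      :* ((x :+ con 1ℚ :- (k :+ con 1ℚ)) :* (x :+ con 1ℚ :+ (k :+ con 1ℚ) :+ con 1ℚ))
    := y :* ((x :- k) :* (x :+ k :+ con 1ℚ))
      :* ((x :+ (k :+ con 1ℚ) :+ con 1ℚ) :* (x :+ (k :+ con 1ℚ) :+ con (ℚof 2)))) refl x (ι k) (h x k)

h-down : ∀ x k → h x (suc k) ≡ h (x + 1ℚ) k * ((x - ι k) * (x - ι k + 1ℚ))
h-down x zero rewrite ι-zero = solve 1 (λ x → con 1ℚ :* ((x :- con 0ℚ) :* (x :+ con 0ℚ :+ con 1ℚ))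
  := con 1ℚ :* ((x :- con 0ℚ) :* (x :- con 0ℚ :+ con 1ℚ))) refl x
h-down x (suc k) = begin
  h x (suc k) * ((x - ι (suc k)) * (x + ι (suc k) + 1ℚ))
    ≡⟨ cong₂ (λ a b → a * ((x - b) * (x + b + 1ℚ))) (h-down x k) (ι-suc k) ⟩
  h (x + 1ℚ) k * ((x - ι k) * (x - ι k + 1ℚ)) * ((x - (ι k + 1ℚ)) * (x + (ι k + 1ℚ) + 1ℚ))
    ≡⟨ solve 3 (λ x k y → y :* ((x :- k) :* (x :- k :+ con 1ℚ)) :* ((x :- (k :+ con 1ℚ)) :* (x :+ (k :+ con 1ℚ) :+ con 1ℚ))
      := y :* ((x :+ con 1ℚ :- k) :* (x :+ con 1ℚ :+ k :+ con 1ℚ)) :* ((x :- (k :+ con 1ℚ)) :* (x :- (k :+ con 1ℚ) :+ con 1ℚ)))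
          refl x (ι k) (h (x + 1ℚ) k) ⟩
  h (x + 1ℚ) (suc k) * ((x - (ι k + 1ℚ)) * (x - (ι k + 1ℚ) + 1ℚ))
    ≡⟨ cong (λ b → h (x + 1ℚ) (suc k) * ((x - b) * (x - b + 1ℚ))) (ι-suc k) ⟨
  h (x + 1ℚ) (suc k) * ((x - ι (suc k)) * (x - ι (suc k) + 1ℚ)) ∎

h-vanish : ∀ N j → h (ι N) (suc N ℕ.+ j) ≡ 0ℚ
h-vanish N zero rewrite ℕₚ.+-identityʳ N =
  solve 2 (λ y n → y :* ((n :- n) :* (n :+ n :+ con 1ℚ)) := con 0ℚ) refl (h (ι N) N) (ι N)
h-vanish N (suc j) rewrite ℕₚ.+-suc N j =
  trans (cong (_* y) (h-vanish N j)) (ℚₚ.*-zeroˡ y)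
  where
  y : ℚ
  y = (ι N - ι (suc N ℕ.+ j)) * (ι N + ι (suc N ℕ.+ j) + 1ℚ)

opaque
  g : ℕ → ℕ → ℚ
  g d zero    = 1ℚ
  g d (suc k) = 1/ι (den d k) * (- ℚof 216 * g d k)

  g-zero : ∀ d → g d 0 ≡ 1ℚ
  g-zero d = refl

  g-rec : ∀ d k → ι (den d k) * g d (suc k) ≡ - ℚof 216 * g d k
  g-rec d k = ι*[1/ι*x]≡x (den d k) (- ℚof 216 * g d k)

sumUpTo-stable : ∀ a j (f : ℕ → ℚ) → (∀ i → f (a ℕ.+ i) ≡ 0ℚ) → sumUpTo (a ℕ.+ j) f ≡ sumUpTo a f
sumUpTo-stable a zero    f f≡0 = cong (λ b → sumUpTo b f) (ℕₚ.+-identityʳ a)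
sumUpTo-stable a (suc j) f f≡0 rewrite ℕₚ.+-suc a j | f≡0 j =
  trans (ℚₚ.+-identityʳ _) (sumUpTo-stable a j f f≡0)

-- The coefficient of t ^ k in w N (ε (1 - 216 t)) is φ N * h N k * g k, where (ε, φ N, d) is
-- (1, 2N + 1, 2) or (- 1, (- 1) ^ N, 0).
module Expansion (d : ℕ) (ε : ℚ) (φ : ℕ → ℚ) (φ0 : φ 0 ≡ 1ℚ) (φ1 : φ 1 ≡ 1ℚ + ℚof 2 * ε)
  (φ1g1 : φ 1 * (ℚof 2 * g d 1) ≡ - (ℚof 432 * ε))
  (φ-rec : ∀ N → φ (suc (suc N)) + φ N ≡ ℚof 2 * ε * φ (suc N))
  (φh-rec : ∀ N k → φ (suc (suc N)) * h (ι N + 1ℚ + 1ℚ) (suc k) + φ N * h (ι N) (suc k)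
     ≡ ℚof 2 * ε * (φ (suc N) * (h (ι N + 1ℚ) (suc k) + (ι k + 1ℚ) * (ι d + ℚof 2 * ι k + 1ℚ) * h (ι N + 1ℚ) k)))
  where

  b : ℕ → ℕ → ℚ
  b N k = φ N * h (ι N) k * g d k

  b-rec : ∀ N k → ι (den d k) * b N (suc k) ≡ ℚof 216 * ((ι k - ι N) * (ι k + ι N + 1ℚ)) * b N k
  b-rec N k = begin
    ι (den d k) * (φ N * (h (ι N) k * ((ι N - ι k) * (ι N + ι k + 1ℚ))) * g d (suc k))
      ≡⟨ solve 6 (λ e f n k y g → e :* (f :* (y :* ((n :- k) :* (n :+ k :+ con 1ℚ))) :* g)
           := f :* (y :* ((n :- k) :* (n :+ k :+ con 1ℚ))) :* (e :* g)) refl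
           (ι (den d k)) (φ N) (ι N) (ι k) (h (ι N) k) (g d (suc k)) ⟩
    φ N * (h (ι N) k * ((ι N - ι k) * (ι N + ι k + 1ℚ))) * (ι (den d k) * g d (suc k))
      ≡⟨ cong (φ N * (h (ι N) k * ((ι N - ι k) * (ι N + ι k + 1ℚ))) *_) (g-rec d k) ⟩
    φ N * (h (ι N) k * ((ι N - ι k) * (ι N + ι k + 1ℚ))) * (- ℚof 216 * g d k)
      ≡⟨ solve 6 (λ c f n k y g → f :* (y :* ((n :- k) :* (n :+ k :+ con 1ℚ))) :* (:- c :* g)
           := c :* ((k :- n) :* (k :+ n :+ con 1ℚ)) :* (f :* y :* g)) refl
           (ℚof 216) (φ N) (ι N) (ι k) (h (ι N) k) (g d k) ⟩
    ℚof 216 * ((ι k - ι N) * (ι k + ι N + 1ℚ)) * b N k ∎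

  b-zero : ∀ N → b N 0 ≡ φ N
  b-zero N rewrite g-zero d = solve 1 (λ f → f :* con 1ℚ :* con 1ℚ := f) refl (φ N)

  b-vanish : ∀ N j → b N (suc N ℕ.+ j) ≡ 0ℚ
  b-vanish N j rewrite h-vanish N j =
    solve 2 (λ f g → f :* con 0ℚ :* g := con 0ℚ) refl (φ N) (g d (suc N ℕ.+ j))

  -- This is the coefficient of `t ^ suc k` in the recurrence of `w` at `ε (1 - 216 t)`. By `g-rec`
  -- the factor `- 216` is traded for `den d k`, which leaves the polynomial identity `φh-rec`.
  b-rowrec : ∀ N k → b (suc (suc N)) (suc k) + b N (suc k) ≡ ℚof 2 * ε * b (suc N) (suc k) - ℚof 432 * ε * b (suc N) k
  b-rowrec N k rewrite ι-suc (suc N) | ι-suc N = begin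
    φ (suc (suc N)) * h (ι N + 1ℚ + 1ℚ) (suc k) * G + φ N * h (ι N) (suc k) * G
      ≡⟨ ℚₚ.*-distribʳ-+ G (φ (suc (suc N)) * h (ι N + 1ℚ + 1ℚ) (suc k)) (φ N * h (ι N) (suc k)) ⟨
    (φ (suc (suc N)) * h (ι N + 1ℚ + 1ℚ) (suc k) + φ N * h (ι N) (suc k)) * G
      ≡⟨ cong (_* G) (φh-rec N k) ⟩
    ℚof 2 * ε * (φ (suc N) * (H1 + (ι k + 1ℚ) * (ι d + ℚof 2 * ι k + 1ℚ) * H)) * G
      ≡⟨ cong (λ E → ℚof 2 * ε * (φ (suc N) * (H1 + E * H)) * G) (ι-den d k) ⟨
    ℚof 2 * ε * (φ (suc N) * (H1 + ι (den d k) * H)) * G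
      ≡⟨ solve 7 (λ two ε f y e z g → two :* ε :* (f :* (y :+ e :* z)) :* g
          := two :* ε :* (f :* y :* g) :+ two :* ε :* f :* z :* (e :* g))
           refl (ℚof 2) ε (φ (suc N)) H1 (ι (den d k)) H G ⟩
    ℚof 2 * ε * (φ (suc N) * H1 * G) + ℚof 2 * ε * φ (suc N) * H * (ι (den d k) * G)
      ≡⟨ cong (λ y → ℚof 2 * ε * (φ (suc N) * H1 * G) + ℚof 2 * ε * φ (suc N) * H * y) (g-rec d k) ⟩
    ℚof 2 * ε * (φ (suc N) * H1 * G) + ℚof 2 * ε * φ (suc N) * H * (- ℚof 216 * g d k)
      ≡⟨ solve 5 (λ u ε f z g → u :+ con (ℚof 2) :* ε :* f :* z :* (:- con (ℚof 216) :* g)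
          := u :- con (ℚof 432) :* ε :* (f :* z :* g))
           refl (ℚof 2 * ε * (φ (suc N) * H1 * G)) ε (φ (suc N)) H (g d k) ⟩
    ℚof 2 * ε * (φ (suc N) * H1 * G) - ℚof 432 * ε * (φ (suc N) * H * g d k) ∎
    where
    G  = g d (suc k)
    H1 = h (ι N + 1ℚ) (suc k)
    H  = h (ι N + 1ℚ) k

  module _ (t : ℚ) where

    F : ℕ → ℕ → ℚ
    F N K = sumUpTo K (λ k → b N k * t ^ k)

    -- Multiplication by `t` raises the degree, so that term is cut off one place earlier; the
    -- identity is then exact at every cut-off.
    F-rec : ∀ N K → F (suc (suc N)) (suc K) + F N (suc K)
                  ≡ ℚof 2 * ε * F (suc N) (suc K) - ℚof 432 * ε * (t * F (suc N) K)
    F-rec N zero rewrite b-zero (suc (suc N)) | b-zero (suc N) | b-zero N = begin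
      (0ℚ + φ (suc (suc N)) * 1ℚ) + (0ℚ + φ N * 1ℚ)
        ≡⟨ solve 2 (λ x y → (con 0ℚ :+ x :* con 1ℚ) :+ (con 0ℚ :+ y :* con 1ℚ)
            := x :+ y) refl (φ (suc (suc N))) (φ N) ⟩
      φ (suc (suc N)) + φ N          ≡⟨ φ-rec N ⟩
      ℚof 2 * ε * φ (suc N)
        ≡⟨ solve 5 (λ two c e t x → two :* e :* x := two :* e :* (con 0ℚ :+ x :* con 1ℚ) :- c :* e :* (t :* con 0ℚ))
             refl (ℚof 2) (ℚof 432) ε t (φ (suc N)) ⟩
      ℚof 2 * ε * (0ℚ + φ (suc N) * 1ℚ) - ℚof 432 * ε * (t * 0ℚ) ∎
    F-rec N (suc K) = begin
      (F (suc (suc N)) (suc K) + b (suc (suc N)) (suc K) * (t * t ^ K)) + (F N (suc K) + b N (suc K) * (t * t ^ K))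
        ≡⟨ solve 5 (λ u v x y s → (u :+ x :* s) :+ (v :+ y :* s) := (u :+ v) :+ (x :+ y) :* s) refl
             (F (suc (suc N)) (suc K)) (F N (suc K)) (b (suc (suc N)) (suc K)) (b N (suc K)) (t * t ^ K) ⟩
      (F (suc (suc N)) (suc K) + F N (suc K)) + (b (suc (suc N)) (suc K) + b N (suc K)) * (t * t ^ K)
        ≡⟨ cong₂ (λ x y → x + y * (t * t ^ K)) (F-rec N K) (b-rowrec N K) ⟩
      (ℚof 2 * ε * F (suc N) (suc K) - ℚof 432 * ε * (t * F (suc N) K))
        + (ℚof 2 * ε * b (suc N) (suc K) - ℚof 432 * ε * b (suc N) K) * (t * t ^ K)
        ≡⟨ solve 8 (λ two c u v x y t s → (two :* u :- c :* (t :* v)) :+ (two :* x :- c :* y) :* (t :* s)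
              := two :* (u :+ x :* (t :* s)) :- c :* (t :* (v :+ y :* s))) refl
             (ℚof 2 * ε) (ℚof 432 * ε) (F (suc N) (suc K)) (F (suc N) K) (b (suc N) (suc K)) (b (suc N) K) t (t ^ K) ⟩
      ℚof 2 * ε * F (suc N) (suc (suc K)) - ℚof 432 * ε * (t * F (suc N) (suc K)) ∎

    F-stable : ∀ N K → N < K → F N K ≡ F N (suc N)
    F-stable N K N<K = begin
      F N K                         ≡⟨ cong (F N) (ℕₚ.m+[n∸m]≡n N<K) ⟨
      F N (suc N ℕ.+ (K ℕ.∸ suc N)) ≡⟨ sumUpTo-stable (suc N) (K ℕ.∸ suc N) (λ k → b N k * t ^ k)
                                         (λ i → trans (cong (_* t ^ (suc N ℕ.+ i)) (b-vanish N i)) (ℚₚ.*-zeroˡ (t ^ (suc N ℕ.+ i)))) ⟩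
      F N (suc N)                   ∎

    -- The cut-off `K` stays free above `N` because one induction step uses row `suc N` at both
    -- `suc K` and `K`.
    w≡F : ∀ y → y ≡ ε * (1ℚ - ℚof 216 * t) → ∀ N K → N < K → w N y ≡ F N K
    w≡F y y≡ zero K 0<K = sym (trans (F-stable 0 K 0<K) (begin
      0ℚ + b 0 0 * 1ℚ     ≡⟨ cong (λ x → 0ℚ + x * 1ℚ) (trans (b-zero 0) φ0) ⟩
      0ℚ + 1ℚ * 1ℚ        ≡⟨⟩
      1ℚ                  ∎))
    w≡F y y≡ (suc zero) K 1<K = sym (trans (F-stable 1 K 1<K) (begin
      0ℚ + b 1 0 * 1ℚ + φ 1 * (1ℚ * ((ι 1 - ι 0) * (ι 1 + ι 0 + 1ℚ))) * g d 1 * (t * 1ℚ)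
        ≡⟨ cong (λ x → 0ℚ + x * 1ℚ + φ 1 * (1ℚ * ((ι 1 - ι 0) * (ι 1 + ι 0 + 1ℚ))) * g d 1 * (t * 1ℚ)) (trans (b-zero 1) φ1) ⟩
      0ℚ + (1ℚ + ℚof 2 * ε) * 1ℚ + φ 1 * (1ℚ * ((ι 1 - ι 0) * (ι 1 + ι 0 + 1ℚ))) * g d 1 * (t * 1ℚ)
        ≡⟨ cong₂ (λ x y → 0ℚ + (1ℚ + ℚof 2 * ε) * 1ℚ + φ 1 * (1ℚ * ((x - y) * (x + y + 1ℚ))) * g d 1 * (t * 1ℚ)) (ι≡ℚof 1) ι-zero ⟩
      0ℚ + (1ℚ + ℚof 2 * ε) * 1ℚ + φ 1 * (1ℚ * ((1ℚ - 0ℚ) * (1ℚ + 0ℚ + 1ℚ))) * g d 1 * (t * 1ℚ)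
        ≡⟨ solve 4 (λ x f g t → con 0ℚ :+ x :* con 1ℚ :+ f :* (con 1ℚ :* ((con 1ℚ :- con 0ℚ) :* (con 1ℚ :+ con 0ℚ :+ con 1ℚ))) :* g :* (t :* con 1ℚ)
              := x :+ f :* (con (ℚof 2) :* g) :* t) refl (1ℚ + ℚof 2 * ε) (φ 1) (g d 1) t ⟩
      1ℚ + ℚof 2 * ε + φ 1 * (ℚof 2 * g d 1) * t
        ≡⟨ cong (λ x → 1ℚ + ℚof 2 * ε + x * t) φ1g1 ⟩
      1ℚ + ℚof 2 * ε + - (ℚof 432 * ε) * t
        ≡⟨ solve 2 (λ e t → con 1ℚ :+ con (ℚof 2) :* e :+ :- (con (ℚof 432) :* e) :* t
              := con 1ℚ :+ con (ℚof 2) :* (e :* (con 1ℚ :- con (ℚof 216) :* t))) refl ε t ⟩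
      1ℚ + ℚof 2 * (ε * (1ℚ - ℚof 216 * t))
        ≡⟨ cong (λ x → 1ℚ + ℚof 2 * x) y≡ ⟨
      1ℚ + ℚof 2 * y ∎))
    w≡F y y≡ (suc (suc N)) (suc K) (s≤s N+1<K) = begin
      ℚof 2 * y * w (suc N) y - w N y
        ≡⟨ cong₂ (λ u v → ℚof 2 * u * w (suc N) y - v) y≡ (w≡F y y≡ N (suc K) (ℕₚ.<-trans (ℕₚ.<-trans (ℕₚ.n<1+n N) N+1<K) (ℕₚ.n<1+n K))) ⟩
      ℚof 2 * (ε * (1ℚ - ℚof 216 * t)) * w (suc N) y - F N (suc K)
        ≡⟨ solve 4 (λ e t u v → con (ℚof 2) :* (e :* (con 1ℚ :- con (ℚof 216) :* t)) :* u :- v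
              := con (ℚof 2) :* e :* u :- con (ℚof 432) :* e :* (t :* u) :- v) refl ε t (w (suc N) y) (F N (suc K)) ⟩
      ℚof 2 * ε * w (suc N) y - ℚof 432 * ε * (t * w (suc N) y) - F N (suc K)
        ≡⟨ cong₂ (λ u v → ℚof 2 * ε * u - ℚof 432 * ε * (t * v) - F N (suc K))
             (w≡F y y≡ (suc N) (suc K) (ℕₚ.<-trans N+1<K (ℕₚ.n<1+n K))) (w≡F y y≡ (suc N) K N+1<K) ⟩
      ℚof 2 * ε * F (suc N) (suc K) - ℚof 432 * ε * (t * F (suc N) K) - F N (suc K)
        ≡⟨ cong (_- F N (suc K)) (F-rec N K) ⟨
      F (suc (suc N)) (suc K) + F N (suc K) - F N (suc K)
        ≡⟨ solve 2 (λ u v → u :+ v :- v := u) refl (F (suc (suc N)) (suc K)) (F N (suc K)) ⟩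
      F (suc (suc N)) (suc K) ∎

-- The values of `w N` at 1 and at -1, that is, the constant coefficients of the two expansions.
φW φV : ℕ → ℚ
φW N = ℚof 2 * ι N + 1ℚ
φV N = (- 1ℚ) ^ N

φW-rec : ∀ N → φW (suc (suc N)) + φW N ≡ ℚof 2 * 1ℚ * φW (suc N)
φW-rec N rewrite ι-suc (suc N) | ι-suc N =
  solve 1 (λ n → con (ℚof 2) :* (n :+ con 1ℚ :+ con 1ℚ) :+ con 1ℚ :+ (con (ℚof 2) :* n :+ con 1ℚ)
    := con (ℚof 2) :* con 1ℚ :* (con (ℚof 2) :* (n :+ con 1ℚ) :+ con 1ℚ)) refl (ι N)

φWh-rec : ∀ N k → φW (suc (suc N)) * h (ι N + 1ℚ + 1ℚ) (suc k) + φW N * h (ι N) (suc k)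
     ≡ ℚof 2 * 1ℚ * (φW (suc N) * (h (ι N + 1ℚ) (suc k) + (ι k + 1ℚ) * (ι 2 + ℚof 2 * ι k + 1ℚ) * h (ι N + 1ℚ) k))
φWh-rec N k rewrite ι≡ℚof 2 | ι-suc (suc N) | ι-suc N | h-up (ι N + 1ℚ) k | h-down (ι N) k =
  solve 3 (λ n k y →
    (con (ℚof 2) :* (n :+ con 1ℚ :+ con 1ℚ) :+ con 1ℚ) :* (y :* ((n :+ con 1ℚ :+ k :+ con 1ℚ) :* (n :+ con 1ℚ :+ k :+ con (ℚof 2))))
    :+ (con (ℚof 2) :* n :+ con 1ℚ) :* (y :* ((n :- k) :* (n :- k :+ con 1ℚ)))
    := con (ℚof 2) :* con 1ℚ :* ((con (ℚof 2) :* (n :+ con 1ℚ) :+ con 1ℚ) :*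
         (y :* ((n :+ con 1ℚ :- k) :* (n :+ con 1ℚ :+ k :+ con 1ℚ)) :+ (k :+ con 1ℚ) :* (con (ℚof 2) :+ con (ℚof 2) :* k :+ con 1ℚ) :* y)))
    refl (ι N) (ι k) (h (ι N + 1ℚ) k)

φVh-rec : ∀ N k → φV (suc (suc N)) * h (ι N + 1ℚ + 1ℚ) (suc k) + φV N * h (ι N) (suc k)
     ≡ ℚof 2 * (- 1ℚ) * (φV (suc N) * (h (ι N + 1ℚ) (suc k) + (ι k + 1ℚ) * (ι 0 + ℚof 2 * ι k + 1ℚ) * h (ι N + 1ℚ) k))
φVh-rec N k rewrite ι-zero | h-up (ι N + 1ℚ) k | h-down (ι N) k =
  solve 4 (λ n k y s →
    (con (- 1ℚ) :* (con (- 1ℚ) :* s)) :* (y :* ((n :+ con 1ℚ :+ k :+ con 1ℚ) :* (n :+ con 1ℚ :+ k :+ con (ℚof 2))))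
    :+ s :* (y :* ((n :- k) :* (n :- k :+ con 1ℚ)))
    := con (ℚof 2) :* con (- 1ℚ) :* ((con (- 1ℚ) :* s) :*
         (y :* ((n :+ con 1ℚ :- k) :* (n :+ con 1ℚ :+ k :+ con 1ℚ)) :+ (k :+ con 1ℚ) :* (con (ℚof 0) :+ con (ℚof 2) :* k :+ con 1ℚ) :* y)))
    refl (ι N) (ι k) (h (ι N + 1ℚ) k) ((- 1ℚ) ^ N)

opaque
  unfolding ι 1/ι g

  φW-zero : φW 0 ≡ 1ℚ
  φW-zero = refl

  φW-one : φW 1 ≡ 1ℚ + ℚof 2 * 1ℚ
  φW-one = refl

  φW-one*g : φW 1 * (ℚof 2 * g 2 1) ≡ - (ℚof 432 * 1ℚ)
  φW-one*g = refl

  φV-one*g : φV 1 * (ℚof 2 * g 0 1) ≡ - (ℚof 432 * - 1ℚ)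
  φV-one*g = refl

module W = Expansion 2 1ℚ φW φW-zero φW-one φW-one*g φW-rec φWh-rec
module V = Expansion 0 (- 1ℚ) φV refl refl φV-one*g
  (λ N → solve 1 (λ s → con (- 1ℚ) :* (con (- 1ℚ) :* s) :+ s
      := con (ℚof 2) :* con (- 1ℚ) :* (con (- 1ℚ) :* s)) refl ((- 1ℚ) ^ N))
  φVh-rec

-- The term ratio of S

opaque
  unfolding ι

  S*den : ∀ k → ι (Sden k) * S k ≡ ι (Snum k)
  S*den k = d*[i/d]≡i (+ Snum k) (Sden k) {{Sden-nz k}}

S-! : ∀ k → ι (2 ℕ.* (2 ℕ.* k ℕ.+ 1)) * (ι ((3 ℕ.* k) !) * (ι ((2 ℕ.* k) !) * ι ((2 ℕ.* k) !))) * S k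
          ≡ ι ((6 ℕ.* k) !) * ι (k !)
S-! k = ι-cancelˡ R {{ℕ.>-nonZero (nCk>0 (2 ℕ.* k) k (ℕₚ.m≤m+n k (k ℕ.+ 0)))}} (begin
  ι R * (ι (2 ℕ.* o) * (ι X * (ι Y * ι Y)) * S k)
    ≡⟨ cong (λ z → ι R * (z * (ι X * (ι Y * ι Y)) * S k)) (ι-* 2 o) ⟩
  ι R * (ι 2 * ι o * (ι X * (ι Y * ι Y)) * S k)
    ≡⟨ solve 6 (λ r two o x y s → r :* (two :* o :* (x :* (y :* y)) :* s)
        := two :* r :* o :* s :* (x :* (y :* y))) refl (ι R) (ι 2) (ι o) (ι X) (ι Y) (S k) ⟩
  ι 2 * ι R * ι o * S k * (ι X * (ι Y * ι Y))
    ≡⟨ cong (λ z → z * S k * (ι X * (ι Y * ι Y))) (trans (ι-* (2 ℕ.* R) o) (cong (_* ι o) (ι-* 2 R))) ⟨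
  ι (Sden k) * S k * (ι X * (ι Y * ι Y))
    ≡⟨ cong (_* (ι X * (ι Y * ι Y))) (S*den k) ⟩
  ι (Snum k) * (ι X * (ι Y * ι Y))
    ≡⟨ cong (ι (Snum k) *_) (trans (ι-* X (Y ℕ.* Y)) (cong (ι X *_) (ι-* Y Y))) ⟨
  ι (Snum k) * ι (X ℕ.* (Y ℕ.* Y))
    ≡⟨ ι-* (Snum k) (X ℕ.* (Y ℕ.* Y)) ⟨
  ι (Snum k ℕ.* (X ℕ.* (Y ℕ.* Y)))
    ≡⟨ cong ι (Snum-! k) ⟩
  ι (R ℕ.* ((6 ℕ.* k) ! ℕ.* k !))
    ≡⟨ trans (ι-* R ((6 ℕ.* k) ! ℕ.* k !)) (cong (ι R *_) (ι-* ((6 ℕ.* k) !) (k !))) ⟩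
  ι R * (ι ((6 ℕ.* k) !) * ι (k !)) ∎)
  where
  R X Y o : ℕ
  R = (2 ℕ.* k) C k
  X = (3 ℕ.* k) !
  Y = (2 ℕ.* k) !
  o = 2 ℕ.* k ℕ.+ 1

α : ℕ → ℚ
α k = ℚof 6 * ((ℚof 6 * ι k + 1ℚ) * (ℚof 6 * ι k + ℚof 5))

ι-linear : ∀ a c k → ι (c ℕ.+ a ℕ.* k) ≡ ℚof c + ℚof a * ι k
ι-linear a c k = trans (ι-+ c (a ℕ.* k)) (cong₂ _+_ (ι≡ℚof c) (trans (ι-* a k) (cong (_* ι k) (ι≡ℚof a))))

ι-prod : ∀ {m n x y} → ι m ≡ x → ι n ≡ y → ι (m ℕ.* n) ≡ x * y
ι-prod {m} {n} refl refl = ι-* m n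

ι-odd : ∀ k → ι (2 ℕ.* k ℕ.+ 1) ≡ ℚof 2 * ι k + 1ℚ
ι-odd k = trans (ι-+ (2 ℕ.* k) 1) (cong₂ _+_ (ι-prod (ι≡ℚof 2) refl) (ι≡ℚof 1))

-- The product `(x + 1) ... (x + c)`, which is `(x + c)! / x!`.
rising : ℚ → ℕ → ℚ
rising x zero    = 1ℚ
rising x (suc c) = (ℚof (suc c) + x) * rising x c

!-rising : ∀ a c k → ι ((c ℕ.+ a ℕ.* k) !) ≡ rising (ℚof a * ι k) c * ι ((a ℕ.* k) !)
!-rising a zero    k = sym (ℚₚ.*-identityˡ (ι ((a ℕ.* k) !)))
!-rising a (suc c) k = begin
  ι ((suc c ℕ.+ a ℕ.* k) !)
    ≡⟨ ι-prod {suc c ℕ.+ a ℕ.* k} {(c ℕ.+ a ℕ.* k) !} (ι-linear a (suc c) k) (!-rising a c k) ⟩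
  (ℚof (suc c) + ℚof a * ι k) * (rising (ℚof a * ι k) c * ι ((a ℕ.* k) !))
    ≡⟨ ℚₚ.*-assoc (ℚof (suc c) + ℚof a * ι k) (rising (ℚof a * ι k) c) (ι ((a ℕ.* k) !)) ⟨
  rising (ℚof a * ι k) (suc c) * ι ((a ℕ.* k) !) ∎

!-rising-suc : ∀ a k → ι ((a ℕ.* suc k) !) ≡ rising (ℚof a * ι k) a * ι ((a ℕ.* k) !)
!-rising-suc a k = trans (cong (λ n → ι (n !)) (ℕₚ.*-suc a k)) (!-rising a a k)

module _ (k : ℕ) where

  private
    κ X Y Z K a b c d : ℚ
    κ = ι k
    X = ι ((3 ℕ.* k) !)
    Y = ι ((2 ℕ.* k) !)
    Z = ι ((6 ℕ.* k) !)
    K = ι (k !)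
    a = κ + 1ℚ
    b = ℚof 2 * κ + 1ℚ
    c = ℚof 3 * κ + 1ℚ
    d = ℚof 3 * κ + ℚof 2

    -- A copy of `rising` in solver syntax whose evaluation computes to the original.
    rising′ : ∀ {n} → ℕ → ℕ → Polynomial n → Polynomial n
    rising′ a zero    κ = con 1ℚ
    rising′ a (suc c) κ = (con (ℚof (suc c)) :+ con (ℚof a) :* κ) :* rising′ a c κ

  [2k+2]! : ι ((2 ℕ.* suc k) !) ≡ ℚof 2 * a * b * Y
  [2k+2]! = trans (!-rising-suc 2 k) (solve 2 (λ κ y → rising′ 2 2 κ :* y
      := con (ℚof 2) :* (κ :+ con 1ℚ) :* (con (ℚof 2) :* κ :+ con 1ℚ) :* y) refl κ Y)

  [3k+3]! : ι ((3 ℕ.* suc k) !) ≡ ℚof 3 * a * c * d * X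
  [3k+3]! = trans (!-rising-suc 3 k) (solve 2 (λ κ y → rising′ 3 3 κ :* y
      := con (ℚof 3) :* (κ :+ con 1ℚ) :* (con (ℚof 3) :* κ :+ con 1ℚ) :* (con (ℚof 3) :* κ :+ con (ℚof 2)) :* y)
          refl κ X)

  -- Four of the six new factors are `6k + 2 = 2c`, `6k + 3 = 3b`, `6k + 4 = 2d` and `6k + 6 = 6a`;
  -- the other two make up `α k`, which also takes a 6 out of 72 and leaves 12.
  [6k+6]! : ι ((6 ℕ.* suc k) !) ≡ ℚof 12 * a * b * c * d * α k * Z
  [6k+6]! = trans (!-rising-suc 6 k) (solve 2 (λ κ y → rising′ 6 6 κ :* y
      := con (ℚof 12) :* (κ :+ con 1ℚ) :* (con (ℚof 2) :* κ :+ con 1ℚ) :* (con (ℚof 3) :* κ :+ con 1ℚ) :* (con (ℚof 3) :* κ :+ con (ℚof 2))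
        :* (con (ℚof 6) :* ((con (ℚof 6) :* κ :+ con 1ℚ) :* (con (ℚof 6) :* κ :+ con (ℚof 5)))) :* y) refl κ Z)

  private
    -- `U` is the factor of `S (suc k)` in `S-! (suc k)` divided by `den 2 k`. The 24 collects the 2
    -- in front, the 3 of `(3k + 3)!` and a 2 from each `(2k + 2)!`.
    U₁ U₂ U : ℕ
    U₁ = 24 ℕ.* (suc k ℕ.* suc k) ℕ.* (suc (2 ℕ.* k) ℕ.* suc (2 ℕ.* k)) ℕ.* (suc (3 ℕ.* k) ℕ.* suc (suc (3 ℕ.* k)))
    U₂ = (3 ℕ.* k) ! ℕ.* ((2 ℕ.* k) ! ℕ.* (2 ℕ.* k) !)
    U  = U₁ ℕ.* U₂

    U≢0 : NonZero U
    U≢0 =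
      ℕₚ.m*n≢0 U₁ U₂ {{_}} {{ℕₚ.m*n≢0 ((3 ℕ.* k) !) ((2 ℕ.* k) ! ℕ.* (2 ℕ.* k) !) {{(3 ℕ.* k) ℕₚ.!≢0}} {{(2 ℕ.* k) ℕₚ.!* (2 ℕ.* k) !≢0}}}}

    ιU : ι U ≡ ℚof 24 * (a * a) * (b * b) * (c * d) * (X * (Y * Y))
    ιU = ι-prod (ι-prod (ι-prod (ι-prod (ι≡ℚof 24) (ι-prod (ι-suc k) (ι-suc k))) (ι-prod ιb ιb)) (ι-prod ιc ιd))
           (ι-prod {(3 ℕ.* k) !} refl (ι-prod {(2 ℕ.* k) !} {(2 ℕ.* k) !} refl refl))
      where
      ιb : ι (suc (2 ℕ.* k)) ≡ b
      ιb = trans (ι-linear 2 1 k) (ℚₚ.+-comm 1ℚ (ℚof 2 * κ))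
      ιc : ι (suc (3 ℕ.* k)) ≡ c
      ιc = trans (ι-linear 3 1 k) (ℚₚ.+-comm 1ℚ (ℚof 3 * κ))
      ιd : ι (suc (suc (3 ℕ.* k))) ≡ d
      ιd = trans (ι-linear 3 2 k) (ℚₚ.+-comm (ℚof 2) (ℚof 3 * κ))

  S-rec : ι (den 2 k) * S (suc k) ≡ α k * S k
  S-rec = ι-cancelˡ U {{U≢0}} (begin
    ι U * (ι (den 2 k) * S (suc k))
      ≡⟨ cong₂ (λ u v → u * (v * S (suc k))) ιU (trans (ι-den 2 k) (cong (λ z → a * (z + ℚof 2 * κ + 1ℚ)) (ι≡ℚof 2))) ⟩
    ℚof 24 * (a * a) * (b * b) * (c * d) * (X * (Y * Y)) * (a * e * S (suc k))
      ≡⟨ solve 8 (λ a b c d e X Y s →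
            con (ℚof 24) :* (a :* a) :* (b :* b) :* (c :* d) :* (X :* (Y :* Y)) :* (a :* e :* s)
            := con (ℚof 2) :* e :* (con (ℚof 3) :* a :* c :* d :* X :* (con (ℚof 2) :* a :* b :* Y :* (con (ℚof 2) :* a :* b :* Y))) :* s)
           refl a b c d e X Y (S (suc k)) ⟩
    ℚof 2 * e * (ℚof 3 * a * c * d * X * (ℚof 2 * a * b * Y * (ℚof 2 * a * b * Y))) * S (suc k)
      ≡⟨ cong₂ (λ u v → ℚof 2 * e * (u * (v * v)) * S (suc k)) [3k+3]! [2k+2]! ⟨
    ℚof 2 * e * (ι ((3 ℕ.* suc k) !) * (ι ((2 ℕ.* suc k) !) * ι ((2 ℕ.* suc k) !))) * S (suc k)
      ≡⟨ cong (λ z → z * (ι ((3 ℕ.* suc k) !) * (ι ((2 ℕ.* suc k) !) * ι ((2 ℕ.* suc k) !))) * S (suc k)) 2e ⟨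
    ι (2 ℕ.* (2 ℕ.* suc k ℕ.+ 1)) * (ι ((3 ℕ.* suc k) !) * (ι ((2 ℕ.* suc k) !) * ι ((2 ℕ.* suc k) !))) * S (suc k)
      ≡⟨ S-! (suc k) ⟩
    ι ((6 ℕ.* suc k) !) * ι (suc k !)
      ≡⟨ cong₂ _*_ [6k+6]! (trans (ι-* (suc k) (k !)) (cong (_* K) (ι-suc k))) ⟩
    ℚof 12 * a * b * c * d * α k * Z * (a * K)
      ≡⟨ solve 7 (λ a b c d α Z K → con (ℚof 12) :* a :* b :* c :* d :* α :* Z :* (a :* K)
           := con (ℚof 12) :* a :* b :* c :* d :* α :* a :* (Z :* K)) refl a b c d (α k) Z K ⟩
    ℚof 12 * a * b * c * d * α k * a * (Z * K)
      ≡⟨ cong (ℚof 12 * a * b * c * d * α k * a *_) (S-! k) ⟨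
    ℚof 12 * a * b * c * d * α k * a * (ι (2 ℕ.* (2 ℕ.* k ℕ.+ 1)) * (X * (Y * Y)) * S k)
      ≡⟨ cong (λ z → ℚof 12 * a * b * c * d * α k * a * (z * (X * (Y * Y)) * S k)) 2b ⟩
    ℚof 12 * a * b * c * d * α k * a * (ℚof 2 * b * (X * (Y * Y)) * S k)
      ≡⟨ solve 8 (λ a b c d α X Y s → con (ℚof 12) :* a :* b :* c :* d :* α :* a :* (con (ℚof 2) :* b :* (X :* (Y :* Y)) :* s)
           := con (ℚof 24) :* (a :* a) :* (b :* b) :* (c :* d) :* (X :* (Y :* Y)) :* (α :* s))
               refl a b c d (α k) X Y (S k) ⟩
    ℚof 24 * (a * a) * (b * b) * (c * d) * (X * (Y * Y)) * (α k * S k)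
      ≡⟨ cong (_* (α k * S k)) ιU ⟨
    ι U * (α k * S k) ∎)
    where
    e : ℚ
    e = ℚof 2 + ℚof 2 * κ + 1ℚ
    2b : ι (2 ℕ.* (2 ℕ.* k ℕ.+ 1)) ≡ ℚof 2 * b
    2b = ι-prod (ι≡ℚof 2) (ι-odd k)
    2e : ι (2 ℕ.* (2 ℕ.* suc k ℕ.+ 1)) ≡ ℚof 2 * e
    2e = trans (ι-prod (ι≡ℚof 2) (trans (ι-odd (suc k)) (cong (λ z → ℚof 2 * z + 1ℚ) (ι-suc k))))
      (solve 1 (λ κ → con (ℚof 2) :* (con (ℚof 2) :* (κ :+ con 1ℚ) :+ con 1ℚ)
          := con (ℚof 2) :* (con (ℚof 2) :+ con (ℚof 2) :* κ :+ con 1ℚ)) refl κ)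

T : ℕ → ℚ
T k = ℚof (2 ℕ.* k ℕ.+ 1) * S k

-- The factor `2k + 3` of `T (suc k)` completes `den 2 k`, and the `2k + 1` of `den 0 k` turns `S k`
-- into `T k`; hence the numerator is unchanged.
T-rec : ∀ k → ι (den 0 k) * T (suc k) ≡ α k * T k
T-rec k = begin
  ι (den 0 k) * T (suc k)
    ≡⟨ cong₂ (λ x y → x * (y * S (suc k))) (trans (ι-den 0 k) (cong (λ z → (ι k + 1ℚ) * (z + ℚof 2 * ι k + 1ℚ)) ι-zero)) (odd (suc k)) ⟩
  (ι k + 1ℚ) * (0ℚ + ℚof 2 * ι k + 1ℚ) * ((ℚof 2 * ι (suc k) + 1ℚ) * S (suc k))
    ≡⟨ cong (λ z → (ι k + 1ℚ) * (0ℚ + ℚof 2 * ι k + 1ℚ) * ((ℚof 2 * z + 1ℚ) * S (suc k))) (ι-suc k) ⟩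
  (ι k + 1ℚ) * (0ℚ + ℚof 2 * ι k + 1ℚ) * ((ℚof 2 * (ι k + 1ℚ) + 1ℚ) * S (suc k))
    ≡⟨ solve 2 (λ κ s → (κ :+ con 1ℚ) :* (con 0ℚ :+ con (ℚof 2) :* κ :+ con 1ℚ) :* ((con (ℚof 2) :* (κ :+ con 1ℚ) :+ con 1ℚ) :* s)
         := (con (ℚof 2) :* κ :+ con 1ℚ) :* ((κ :+ con 1ℚ) :* (con (ℚof 2) :+ con (ℚof 2) :* κ :+ con 1ℚ) :* s))
             refl (ι k) (S (suc k)) ⟩
  (ℚof 2 * ι k + 1ℚ) * ((ι k + 1ℚ) * (ℚof 2 + ℚof 2 * ι k + 1ℚ) * S (suc k))
    ≡⟨ cong (λ z → (ℚof 2 * ι k + 1ℚ) * (z * S (suc k))) (trans (ι-den 2 k) (cong (λ z → (ι k + 1ℚ) * (z + ℚof 2 * ι k + 1ℚ)) (ι≡ℚof 2))) ⟨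
  (ℚof 2 * ι k + 1ℚ) * (ι (den 2 k) * S (suc k))
    ≡⟨ cong ((ℚof 2 * ι k + 1ℚ) *_) (S-rec k) ⟩
  (ℚof 2 * ι k + 1ℚ) * (α k * S k)
    ≡⟨ solve 3 (λ x y z → x :* (y :* z) := y :* (x :* z)) refl (ℚof 2 * ι k + 1ℚ) (α k) (S k) ⟩
  α k * ((ℚof 2 * ι k + 1ℚ) * S k)
    ≡⟨ cong (λ z → α k * (z * S k)) (odd k) ⟨
  α k * T k ∎
  where
  odd : ∀ k → ℚof (2 ℕ.* k ℕ.+ 1) ≡ ℚof 2 * ι k + 1ℚ
  odd k = trans (sym (ι≡ℚof (2 ℕ.* k ℕ.+ 1))) (ι-odd k)

-- Transfer of congruences along first-order recurrences

sumUpTo-+ : ∀ a b (f : ℕ → ℚ) → sumUpTo (a ℕ.+ b) f ≡ sumUpTo a f + sumUpTo b (λ i → f (a ℕ.+ i))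
sumUpTo-+ a zero f = trans (cong (λ c → sumUpTo c f) (ℕₚ.+-identityʳ a)) (sym (ℚₚ.+-identityʳ (sumUpTo a f)))
sumUpTo-+ a (suc b) f = begin
  sumUpTo (a ℕ.+ suc b) f                     ≡⟨ cong (λ c → sumUpTo c f) (ℕₚ.+-suc a b) ⟩
  sumUpTo (a ℕ.+ b) f + f (a ℕ.+ b)           ≡⟨ cong (_+ f (a ℕ.+ b)) (sumUpTo-+ a b f) ⟩
  sumUpTo a f + sumUpTo b (λ i → f (a ℕ.+ i)) + f (a ℕ.+ b)
    ≡⟨ ℚₚ.+-assoc (sumUpTo a f) (sumUpTo b (λ i → f (a ℕ.+ i))) (f (a ℕ.+ b)) ⟩
  sumUpTo a f + sumUpTo (suc b) (λ i → f (a ℕ.+ i)) ∎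

β : ℕ → ℕ → ℚ
β N k = ℚof 216 * ((ι k - ι N) * (ι k + ι N + 1ℚ))

module Proportional (p : ℕ) (pp : Prime p) where
  open Localisation p pp public

  -- Integrality is stored only for `B`, which multiplies an error term in `step`; for integral `c`
  -- that of `A` follows.
  record Rel (c A B : ℚ) : Set where
    constructor rel
    field
      integral : D B
      congr    : I (A - c * B)
  open Rel public

  -- Up to the unit `u` the new error is `α (A - c B) + c B (α - κ β)`. The constant `κ` differs
  -- from 1 only at the passage over `k = n`.
  step : ∀ u .{{_ : NonZero u}} {α β κ c A B A′ B′} → ¬ p ∣ u → D α → D β → D c → I (α - κ * β) →
    ι u * A′ ≡ α * A → ι u * B′ ≡ β * B → Rel c A B → Rel (c * κ) A′ B′
  step u {α} {β} {κ} {c} {A} {B} {A′} {B′} p∤u Dα Dβ Dc α≡κβ eqA eqB (rel DB A≡cB) = rel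
    (D-cancel u p∤u (subst D (sym eqB) (D-* Dβ DB)))
    (I-cancel u p∤u (subst I (sym eq) (I-+ (I-* Dα A≡cB) (I-* (D-* Dc DB) α≡κβ))))
    where
    eq : ι u * (A′ - c * κ * B′) ≡ α * (A - c * B) + c * B * (α - κ * β)
    eq = begin
      ι u * (A′ - c * κ * B′)
        ≡⟨ solve 5 (λ u A c κ B → u :* (A :- c :* κ :* B) := u :* A :- c :* κ :* (u :* B)) refl (ι u) A′ c κ B′ ⟩
      ι u * A′ - c * κ * (ι u * B′)     ≡⟨ cong₂ (λ x y → x - c * κ * y) eqA eqB ⟩
      α * A - c * κ * (β * B)
        ≡⟨ solve 6 (λ α β κ c A B → α :* A :- c :* κ :* (β :* B)
            := α :* (A :- c :* B) :+ c :* B :* (α :- κ :* β)) refl α β κ c A B ⟩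
      α * (A - c * B) + c * B * (α - κ * β) ∎

  step₁ : ∀ u .{{_ : NonZero u}} {α β c A B A′ B′} → ¬ p ∣ u → D α → D β → D c → I (α - β) →
    ι u * A′ ≡ α * A → ι u * B′ ≡ β * B → Rel c A B → Rel c A′ B′
  step₁ u {α} {β} {c} {A′ = A′} {B′} p∤u Dα Dβ Dc α≡β eqA eqB r =
    subst (λ x → Rel x A′ B′) (ℚₚ.*-identityʳ c)
      (step u p∤u Dα Dβ Dc (subst (λ x → I (α - x)) (sym (ℚₚ.*-identityˡ β)) α≡β) eqA eqB r)

  iterate : ∀ {e : ℕ → ℕ} {{_ : ∀ {k} → NonZero (e k)}} {α β A B : ℕ → ℚ} {c} → D c →
    (∀ k → D (α k)) → (∀ k → D (β k)) → (∀ k → I (α k - β k)) →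
    (∀ k → ι (e k) * A (suc k) ≡ α k * A k) → (∀ k → ι (e k) * B (suc k) ≡ β k * B k) →
    ∀ {a} b → a ≤ b → (∀ i → a ≤ i → i < b → ¬ p ∣ e i) → Rel c (A a) (B a) → Rel c (A b) (B b)
  iterate Dc Dα Dβ α≡β eqA eqB zero z≤n p∤e r = r
  iterate {e} {α} {β} {A} {B} {c} Dc Dα Dβ α≡β eqA eqB {a} (suc b) a≤1+b p∤e r with ℕₚ.m≤n⇒m<n∨m≡n a≤1+b
  ... | inj₂ refl = r
  ... | inj₁ (s≤s a≤b) = step₁ (e b) (p∤e b a≤b (ℕₚ.n<1+n b)) (Dα b) (Dβ b) Dc (α≡β b) (eqA b) (eqB b)
    (iterate Dc Dα Dβ α≡β eqA eqB b a≤b (λ i a≤i i<b → p∤e i a≤i (ℕₚ.m<n⇒m<1+n i<b)) r)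

  D-lit : ∀ a → D (ℚof a)
  D-lit a = D-ℤ (+ a)

  D-- : ∀ {x y} → D x → D y → D (x - y)
  D-- Dx Dy = D-+ Dx (D-neg Dy)

  D-^ : ∀ {x} → D x → ∀ k → D (x ^ k)
  D-^ Dx zero    = D-lit 1
  D-^ Dx (suc k) = D-* Dx (D-^ Dx k)

  D-α : ∀ k → D (α k)
  D-α k = D-* (D-lit 6) (D-* (D-+ (D-* (D-lit 6) (D-ι k)) (D-lit 1)) (D-+ (D-* (D-lit 6) (D-ι k)) (D-lit 5)))

  D-β : ∀ N k → D (β N k)
  D-β N k = D-* (D-lit 216) (D-* (D-- (D-ι k) (D-ι N)) (D-+ (D-+ (D-ι k) (D-ι N)) (D-lit 1)))

  I-sum : ∀ c (f g : ℕ → ℚ) K → (∀ i → i < K → I (f i - c * g i)) → I (sumUpTo K f - c * sumUpTo K g)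
  I-sum c f g zero f≡cg = subst I (solve 2 (λ p c → p :* con 0ℚ
      := con 0ℚ :- c :* con 0ℚ) refl (ι p) c) (I-p (D-lit 0))
  I-sum c f g (suc K) f≡cg = subst I
    (solve 5 (λ a b c x y → (a :- c :* b) :+ (x :- c :* y)
        := (a :+ x) :- c :* (b :+ y)) refl (sumUpTo K f) (sumUpTo K g) c (f K) (g K))
    (I-+ (I-sum c f g K (λ i i<K → f≡cg i (ℕₚ.m<n⇒m<1+n i<K))) (f≡cg K (ℕₚ.n<1+n K)))

  I-term : ∀ c x y {s} → D s → I (x - c * y) → I (x * s - c * (y * s))
  I-term c x y {s} Ds x≡cy = subst I (solve 4 (λ c x y s → s :* (x :- c :* y)
      := x :* s :- c :* (y :* s)) refl c x y s) (I-* Ds x≡cy)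

-- Proportionality across the zero and the pole of the ratios modulo p

instance
  den≢0 : ∀ {d k} → NonZero (den d k)
  den≢0 = _

-- Both series share everything except `d` and `q`. In `eqr` the number `r` is the cofactor of `p`,
-- and `eqr′` says that `α n / p = 6r` is congruent to `1/6` of `β m n / p = 216 (n - m)`.
module Transfer (p : ℕ) (pp : Prime p) (p∤2 : ¬ p ∣ 2) (p∤6 : ¬ p ∣ 6) (d n m q r : ℕ)
  (1+n+m≡p : suc (n ℕ.+ m) ≡ p) (1+d+2q≡p : suc (d ℕ.+ 2 ℕ.* q) ≡ p) (n<q : n < q)
  (eqr : (ℚof 6 * ι n + 1ℚ) * (ℚof 6 * ι n + ℚof 5) ≡ ι p * ι r)
  (eqr′ : ℚof 6 * ι r - ℚof 36 * (ι n - ι m) ≡ ι p * ℚof 30)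
  where
  open Proportional p pp

  private
    instance
      p≢0 : NonZero p
      p≢0 = prime⇒nonZero pp

  q<p : q < p
  q<p = subst (q <_) 1+d+2q≡p (s≤s (ℕₚ.≤-trans (ℕₚ.m≤m+n q (q ℕ.+ 0)) (ℕₚ.m≤n+m (2 ℕ.* q) d)))

  m<p : m < p
  m<p = subst (m <_) 1+n+m≡p (s≤s (ℕₚ.m≤n+m m n))

  p∤low : ∀ i → i < q → ¬ p ∣ den d i
  p∤low i i<q =
    _⋆_ {suc i} (>⇒∤ (ℕₚ.≤-<-trans i<q q<p)) $ >⇒∤ (subst (suc (d ℕ.+ 2 ℕ.* i) <_) 1+d+2q≡p (s≤s (ℕₚ.+-monoʳ-< d (ℕₚ.*-monoʳ-< 2 i<q))))

  -- The second factor of `den d i` is `p + 2 (i - q)`; were it divisible by `p`, so would be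
  -- `2 (i - q)`, although `0 < i - q < p`.
  p∤high : ∀ i → q < i → i < m → ¬ p ∣ den d i
  p∤high i q<i i<m = >⇒∤ (ℕₚ.≤-<-trans i<m m<p) ⋆ λ p∣x →
    (p∤2 ⋆ >⇒∤ {{ℕ.>-nonZero (ℕₚ.m<n⇒0<n∸m q<i)}} (ℕₚ.≤-<-trans (ℕₚ.m∸n≤m i q) (ℕₚ.<-trans i<m m<p)))
      (∣m+n∣m⇒∣n (subst (p ∣_) (sym split) p∣x) ∣-refl)
    where
    split : p ℕ.+ 2 ℕ.* (i ∸ q) ≡ suc (d ℕ.+ 2 ℕ.* i)
    split = trans (cong (ℕ._+ 2 ℕ.* (i ∸ q)) (sym 1+d+2q≡p)) (odd-split d q i (ℕₚ.<⇒≤ q<i))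

  ιp≡ : ι n + ι m + 1ℚ ≡ ι p
  ιp≡ = trans (cong (_+ 1ℚ) (sym (ι-+ n m))) (trans (sym (ι-suc (n ℕ.+ m))) (cong ι 1+n+m≡p))

  α≡βn : ∀ k → I (α k - β n k)
  α≡βn k = subst I (sym eq) (I-p (D-* (D-lit 6) (D-ι r)))
    where
    eq : α k - β n k ≡ ι p * (ℚof 6 * ι r)
    eq = begin
      α k - β n k
        ≡⟨ solve 2 (λ k n → con (ℚof 6) :* ((con (ℚof 6) :* k :+ con 1ℚ) :* (con (ℚof 6) :* k :+ con (ℚof 5)))
             :- con (ℚof 216) :* ((k :- n) :* (k :+ n :+ con 1ℚ))
             := con (ℚof 6) :* ((con (ℚof 6) :* n :+ con 1ℚ) :* (con (ℚof 6) :* n :+ con (ℚof 5)))) refl (ι k) (ι n) ⟩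
      ℚof 6 * ((ℚof 6 * ι n + 1ℚ) * (ℚof 6 * ι n + ℚof 5))     ≡⟨ cong (ℚof 6 *_) eqr ⟩
      ℚof 6 * (ι p * ι r)    ≡⟨ solve 3 (λ a p r → a :* (p :* r) := p :* (a :* r)) refl (ℚof 6) (ι p) (ι r) ⟩
      ι p * (ℚof 6 * ι r) ∎

  βn≡βm : ∀ k → β m k - β n k ≡ ι p * (ℚof 216 * (ι n - ι m))
  βn≡βm k = trans
    (solve 3 (λ k n m → con (ℚof 216) :* ((k :- m) :* (k :+ m :+ con 1ℚ)) :- con (ℚof 216) :* ((k :- n) :* (k :+ n :+ con 1ℚ))
      := (n :+ m :+ con 1ℚ) :* (con (ℚof 216) :* (n :- m))) refl (ι k) (ι n) (ι m))
    (cong (_* (ℚof 216 * (ι n - ι m))) ιp≡)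

  D-n-m : D (ℚof 216 * (ι n - ι m))
  D-n-m = D-* (D-lit 216) (D-- (D-ι n) (D-ι m))

  βm≡βn : ∀ k → I (β m k - β n k)
  βm≡βn k = subst I (sym (βn≡βm k)) (I-p D-n-m)

  α≡βm : ∀ k → I (α k - β m k)
  α≡βm k = subst I (solve 3 (λ a b c → (a :- b) :+ con (- 1ℚ) :* (c :- b) := a :- c) refl (α k) (β n k) (β m k))
    (I-+ (α≡βn k) (I-* (D-neg (D-lit 1)) (βm≡βn k)))

  1/6ℚ : ℚ
  1/6ℚ = frac (+ 1) 6

  D-1/6 : D 1/6ℚ
  D-1/6 = D-by 6 p∤6 (+ 1) refl

  -- `σ` is the residue of the constant coefficient of `w m` over that of `w n`: it is -1 around 1,
  -- where `2m + 1 = 2p - (2n + 1)`, and 1 around -1.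
  module _ {A Bn Bm : ℕ → ℚ} {c σ : ℚ} (Dc : D c) (Dσ : D σ)
    (A-rec  : ∀ k → ι (den d k) * A (suc k) ≡ α k * A k)
    (Bn-rec : ∀ k → ι (den d k) * Bn (suc k) ≡ β n k * Bn k)
    (Bm-rec : ∀ k → ι (den d k) * Bm (suc k) ≡ β m k * Bm k)
    (Bn-vanish : ∀ j → Bn (suc n ℕ.+ j) ≡ 0ℚ)
    (A∼Bn : Rel c (A 0) (Bn 0)) (A∼Bm : Rel (c * σ) (A 0) (Bm 0)) (Bm∼Bn : Rel σ (Bm 0) (Bn 0))
    where

    private
      Dcσ : D (c * σ)
      Dcσ = D-* Dc Dσ

      c′ : ℚ
      c′ = c * σ * 1/6ℚ

      Dc′ : D c′
      Dc′ = D-* Dcσ D-1/6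

      p⁻¹ : ℚ
      p⁻¹ = 1/ι p

    p∤≤n : ∀ {k} → k ≤ n → ∀ i → 0 ≤ i → i < k → ¬ p ∣ den d i
    p∤≤n k≤n i _ i<k = p∤low i (ℕₚ.<-trans (ℕₚ.<-≤-trans i<k k≤n) n<q)

    A∼Bn-low : ∀ k → k ≤ n → Rel c (A k) (Bn k)
    A∼Bn-low k k≤n = iterate {e = den d} {A = A} {B = Bn} Dc D-α (D-β n) α≡βn A-rec Bn-rec k z≤n (p∤≤n k≤n) A∼Bn

    Bm∼Bn-low : ∀ k → k ≤ n → Rel σ (Bm k) (Bn k)
    Bm∼Bn-low k k≤n =
      iterate {e = den d} {A = Bm} {B = Bn} Dσ (D-β m) (D-β n) βm≡βn Bm-rec Bn-rec k z≤n (p∤≤n k≤n) Bm∼Bn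

    A∼Bm-n : Rel (c * σ) (A n) (Bm n)
    A∼Bm-n = iterate {e = den d} {A = A} {B = Bm} Dcσ D-α (D-β m) α≡βm A-rec Bm-rec n z≤n (p∤≤n ℕₚ.≤-refl) A∼Bm

    rec/p : ∀ u x y z → u * y ≡ x * z → u * (p⁻¹ * y) ≡ x * (p⁻¹ * z)
    rec/p u x y z eq = begin
      u * (p⁻¹ * y)   ≡⟨ solve 3 (λ a b c → a :* (b :* c) := b :* (a :* c)) refl u p⁻¹ y ⟩
      p⁻¹ * (u * y)   ≡⟨ cong (p⁻¹ *_) eq ⟩
      p⁻¹ * (x * z)   ≡⟨ solve 3 (λ a b c → a :* (b :* c) := b :* (a :* c)) refl p⁻¹ x z ⟩
      x * (p⁻¹ * z)   ∎

    -- Entry into the rescaled range: the factor `p` of the numerator pays for the `p⁻¹` of the new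
    -- term, so the old term stays unscaled.
    rec/p′ : ∀ u x v y z → x ≡ ι p * v → u * y ≡ x * z → u * (p⁻¹ * y) ≡ v * z
    rec/p′ u x v y z x≡ eq = begin
      u * (p⁻¹ * y)           ≡⟨ rec/p u x y z eq ⟩
      x * (p⁻¹ * z)           ≡⟨ cong (_* (p⁻¹ * z)) x≡ ⟩
      ι p * v * (p⁻¹ * z)     ≡⟨ solve 4 (λ a b c d → a :* b :* (c :* d) := c :* (a :* (b :* d))) refl (ι p) v p⁻¹ z ⟩
      p⁻¹ * (ι p * (v * z))   ≡⟨ 1/ι-cancel p (v * z) ⟩
      v * z                   ∎

    -- Both α n and β m n are divisible by p; dividing this factor out changes the
    -- constant of proportionality by 1/6.
    A∼Bm-1+n : Rel c′ (p⁻¹ * A (suc n)) (p⁻¹ * Bm (suc n))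
    A∼Bm-1+n =
      step (den d n) {κ = 1/6ℚ} (p∤low n n<q) (D-* (D-lit 6) (D-ι r)) D-n-m Dcσ (subst I (sym κ-eq) (I-p (D-lit 30)))
      (rec/p′ (ι (den d n)) (α n) (ℚof 6 * ι r) (A (suc n)) (A n) αn (A-rec n))
      (rec/p′ (ι (den d n)) (β m n) (ℚof 216 * (ι n - ι m)) (Bm (suc n)) (Bm n) βn (Bm-rec n)) A∼Bm-n
      where
      αn : α n ≡ ι p * (ℚof 6 * ι r)
      αn = trans (cong (ℚof 6 *_) eqr) (solve 3 (λ a p r → a :* (p :* r) := p :* (a :* r)) refl (ℚof 6) (ι p) (ι r))
      βn : β m n ≡ ι p * (ℚof 216 * (ι n - ι m))
      βn = trans (solve 2 (λ n m → con (ℚof 216) :* ((n :- m) :* (n :+ m :+ con 1ℚ))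
          := (n :+ m :+ con 1ℚ) :* (con (ℚof 216) :* (n :- m)))
        refl (ι n) (ι m)) (cong (_* (ℚof 216 * (ι n - ι m))) ιp≡)
      κ-eq : ℚof 6 * ι r - 1/6ℚ * (ℚof 216 * (ι n - ι m)) ≡ ι p * ℚof 30
      κ-eq = trans (solve 2 (λ r x → con (ℚof 6) :* r :- con 1/6ℚ :* (con (ℚof 216) :* x)
          := con (ℚof 6) :* r :- con (ℚof 36) :* x)
        refl (ι r) (ι n - ι m)) eqr′

    -- Its `integral` component shows that `p` divides `Bm k` here; at `k = q` the relation is also
    -- the starting point for the range beyond.
    A∼Bm-middle : ∀ k → n < k → k ≤ q → Rel c′ (p⁻¹ * A k) (p⁻¹ * Bm k)
    A∼Bm-middle k n<k k≤q = iterate {e = den d} {A = λ k → p⁻¹ * A k} {B = λ k → p⁻¹ * Bm k} Dc′ D-α (D-β m) α≡βm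
      (λ k → rec/p (ι (den d k)) (α k) (A (suc k)) (A k) (A-rec k))
      (λ k → rec/p (ι (den d k)) (β m k) (Bm (suc k)) (Bm k) (Bm-rec k))
      k n<k (λ i _ i<k → p∤low i (ℕₚ.<-≤-trans i<k k≤q)) A∼Bm-1+n

    A∼Bm-1+q : Rel c′ (A (suc q)) (Bm (suc q))
    -- Since `den d q` is `suc q` times `p`, its `p` restores the unscaled terms, and only the unit
    -- `suc q` is left to divide by.
    A∼Bm-1+q = step₁ (suc q) p∤1+q (D-α q) (D-β m q) Dc′ (α≡βm q) 
      (cancel-p (α q) (A q) (A (suc q)) (A-rec q)) (cancel-p (β m q) (Bm q) (Bm (suc q)) (Bm-rec q)) (A∼Bm-middle q n<q ℕₚ.≤-refl)
      where
      p∤1+q : ¬ p ∣ suc q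
      -- For `d = 0` the inequality `1 + q < 1 + d + 2q` needs `q > 0`, which `n < q` provides.
      p∤1+q = >⇒∤ (subst (suc q <_) 1+d+2q≡p (s≤s (ℕₚ.≤-trans
        (ℕₚ.≤-trans (subst (_≤ q ℕ.+ q) (ℕₚ.+-comm q 1) (ℕₚ.+-monoʳ-≤ q (ℕₚ.≤-trans (s≤s z≤n) n<q)))
          (ℕₚ.≤-reflexive (cong (q ℕ.+_) (sym (ℕₚ.+-identityʳ q)))))
        (ℕₚ.m≤n+m (2 ℕ.* q) d))))
      cancel-p : ∀ x X Y → ι (den d q) * Y ≡ x * X → ι (suc q) * Y ≡ x * (p⁻¹ * X)
      cancel-p x X Y eq = begin
        ι (suc q) * Y                       ≡⟨ 1/ι-cancel p (ι (suc q) * Y) ⟨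
        p⁻¹ * (ι p * (ι (suc q) * Y))
          ≡⟨ cong (p⁻¹ *_) (solve 3 (λ a b c → a :* (b :* c) := b :* a :* c) refl (ι p) (ι (suc q)) Y) ⟩
        p⁻¹ * (ι (suc q) * ι p * Y)
          ≡⟨ cong (λ z → p⁻¹ * (z * Y)) (trans (sym (ι-* (suc q) p)) (cong (λ z → ι (suc q ℕ.* z)) (sym 1+d+2q≡p))) ⟩
        p⁻¹ * (ι (den d q) * Y)             ≡⟨ cong (p⁻¹ *_) eq ⟩
        p⁻¹ * (x * X)                       ≡⟨ solve 3 (λ a b c → a :* (b :* c) := b :* (a :* c)) refl p⁻¹ x X ⟩
        x * (p⁻¹ * X)                       ∎

    A∼Bm-high : ∀ k → q < k → k ≤ m → Rel c′ (A k) (Bm k)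
    A∼Bm-high k q<k k≤m = iterate {e = den d} {A = A} {B = Bm} Dc′ D-α (D-β m) α≡βm A-rec Bm-rec k q<k
      (λ i q<i i<k → p∤high i q<i (ℕₚ.<-≤-trans i<k k≤m)) A∼Bm-1+q

    -- Up to `n` the initial values decide; from there to `q` the term `Bn k` is zero and `Bm k` is
    -- a multiple of `p`.
    Bm≡σBn : ∀ k → k ≤ q → I (Bm k - σ * Bn k)
    Bm≡σBn k k≤q with k ℕ.≤? n
    ... | yes k≤n = congr (Bm∼Bn-low k k≤n)
    ... | no  k≰n = subst I eq (I-p (integral (A∼Bm-middle k n<k k≤q)))
      where
      n<k : n < k
      n<k = ℕₚ.≰⇒> k≰n
      eq : ι p * (p⁻¹ * Bm k) ≡ Bm k - σ * Bn k
      eq = begin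
        ι p * (p⁻¹ * Bm k)    ≡⟨ ι*[1/ι*x]≡x p (Bm k) ⟩
        Bm k                  ≡⟨ solve 2 (λ x s → x := x :- s :* con 0ℚ) refl (Bm k) σ ⟩
        Bm k - σ * 0ℚ
          ≡⟨ cong (λ z → Bm k - σ * z) (trans (cong Bn (sym (ℕₚ.m+[n∸m]≡n n<k))) (Bn-vanish (k ∸ suc n))) ⟨
        Bm k - σ * Bn k       ∎

    module _ (t : ℚ) (Dt : D t) where

      sum-low : I (sumUpTo (suc n) (λ k → A k * t ^ k) - c * sumUpTo (suc n) (λ k → Bn k * t ^ k))
      sum-low =
        I-sum c (λ k → A k * t ^ k) (λ k → Bn k * t ^ k) (suc n)
          (λ { k (s≤s k≤n) → I-term c (A k) (Bn k) (D-^ Dt k) (congr (A∼Bn-low k k≤n)) })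

      -- The terms of `w m` beyond `q` are all its terms minus those up to `q`, and by `Bm≡σBn` the
      -- latter sum to `σ` times the sum of the `Bn` terms.
      sum-high : q ≤ m → I (sumUpTo (m ∸ q) (λ i → A (suc q ℕ.+ i) * t ^ (suc q ℕ.+ i))
        - c′ * (sumUpTo (suc m) (λ k → Bm k * t ^ k) - σ * sumUpTo (suc q) (λ k → Bn k * t ^ k)))
      sum-high q≤m = subst I eq (I-+ high (I-* (D-neg Dc′) low))
        where
        a b : ℕ → ℚ
        a k = A k * t ^ k
        b k = Bm k * t ^ k
        X Y Z V : ℚ
        X = sumUpTo (m ∸ q) (λ i → a (suc q ℕ.+ i))
        Y = sumUpTo (m ∸ q) (λ i → b (suc q ℕ.+ i))
        Z = sumUpTo (suc q) b
        V = sumUpTo (suc q) (λ k → Bn k * t ^ k)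
        high : I (X - c′ * Y)
        high =
          I-sum c′ (λ i → a (suc q ℕ.+ i)) (λ i → b (suc q ℕ.+ i)) (m ∸ q)
            (λ i i<m∸q → I-term c′ (A (suc q ℕ.+ i)) (Bm (suc q ℕ.+ i)) (D-^ Dt (suc q ℕ.+ i))
          (congr (A∼Bm-high (suc q ℕ.+ i) (ℕₚ.m≤m+n (suc q) i)
            (subst (suc q ℕ.+ i ≤_) (ℕₚ.m+[n∸m]≡n q≤m) (subst (_≤ q ℕ.+ (m ∸ q)) (ℕₚ.+-suc q i) (ℕₚ.+-monoʳ-≤ q i<m∸q))))))
        low : I (Z - σ * V)
        low =
          I-sum σ b (λ k → Bn k * t ^ k) (suc q) (λ { k (s≤s k≤q) → I-term σ (Bm k) (Bn k) (D-^ Dt k) (Bm≡σBn k k≤q) })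
        eq : (X - c′ * Y) + - c′ * (Z - σ * V) ≡ X - c′ * (sumUpTo (suc m) b - σ * V)
        eq = begin
          (X - c′ * Y) + - c′ * (Z - σ * V)
            ≡⟨ solve 6 (λ X Y Z V c s → (X :- c :* Y) :+ :- c :* (Z :- s :* V)
                := X :- c :* ((Z :+ Y) :- s :* V)) refl X Y Z V c′ σ ⟩
          X - c′ * ((Z + Y) - σ * V)
            ≡⟨ cong (λ z → X - c′ * (z - σ * V)) (trans (sym (sumUpTo-+ (suc q) (m ∸ q) b))
                 (cong (λ z → sumUpTo (suc z) b) (ℕₚ.m+[n∸m]≡n q≤m))) ⟩
          X - c′ * (sumUpTo (suc m) b - σ * V) ∎

-- The four congruences

-- Floors and Legendre symbol are abstracted so that a single transport can replace them by explicit
-- values.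
Claims : ℕ → ℚ → (n m a b : ℕ) → ℚ → Set
Claims p t n m a b L =
    (Σ[ 0 , n ] (λ k → S k * t ^ k)
       ≡ frac (+ 3) 4 * L * w n (1ℚ - ℚof 216 * t) [mod p ])
  × (Σ[ a , m ] (λ k → S k * t ^ k)
       ≡ (- frac (+ 1) 8) * L * (w m (1ℚ - ℚof 216 * t) + w n (1ℚ - ℚof 216 * t)) [mod p ])
  × (Σ[ 0 , n ] (λ k → ℚof (2 ℕ.* k ℕ.+ 1) * S k * t ^ k)
       ≡ frac (+ 1) 2 * (- 1ℚ) ^ a * w n (ℚof 216 * t - 1ℚ) [mod p ])
  × (Σ[ b , m ] (λ k → ℚof (2 ℕ.* k ℕ.+ 1) * S k * t ^ k)
       ≡ frac (+ 1) 12 * (- 1ℚ) ^ a * (w m (ℚof 216 * t - 1ℚ) - w n (ℚof 216 * t - 1ℚ)) [mod p ])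

sign : ℕ → ℚ
sign k = (- 1ℚ) ^ k

sign-square : ∀ k → sign k * sign k ≡ 1ℚ
sign-square zero    = refl
sign-square (suc k) = trans (solve 1 (λ s → con (- 1ℚ) :* s :* (con (- 1ℚ) :* s)
    := s :* s) refl (sign k)) (sign-square k)

sign-+ : ∀ a b → sign (a ℕ.+ b) ≡ sign a * sign b
sign-+ zero    b = sym (ℚₚ.*-identityˡ (sign b))
sign-+ (suc a) b = trans (cong (- 1ℚ *_) (sign-+ a b)) (sym (ℚₚ.*-assoc (- 1ℚ) (sign a) (sign b)))

sign-even : ∀ {k l} j → k ≡ j ℕ.+ j ℕ.+ l → sign k ≡ sign l
sign-even {l = l} j refl = begin
  sign (j ℕ.+ j ℕ.+ l)        ≡⟨ sign-+ (j ℕ.+ j) l ⟩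
  sign (j ℕ.+ j) * sign l     ≡⟨ cong (_* sign l) (trans (sign-+ j j) (sign-square j)) ⟩
  1ℚ * sign l                 ≡⟨ ℚₚ.*-identityˡ (sign l) ⟩
  sign l                      ∎

-- `q = (p - 3)/2` is the pole for `S`, and `suc q` the one for `T`; hence the lower limits
-- `(p - 1)/2` and `(p + 1)/2`. `eqL` compares `S 0 = 1/2` with `3/4 L (2n + 1)` modulo `p`.
module Core (p : ℕ) (pp : Prime p) (3<p : 3 < p) (t : ℚ) (InDt : InD p t) (n m q r : ℕ) (L : ℚ)
  (1+n+m≡p : suc (n ℕ.+ m) ≡ p) (3+2q≡p : suc (2 ℕ.+ 2 ℕ.* q) ≡ p) (n<q : n < q) (q<m : q < m)
  (eqr : (ℚof 6 * ι n + 1ℚ) * (ℚof 6 * ι n + ℚof 5) ≡ ι p * ι r)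
  (eqr′ : ℚof 6 * ι r - ℚof 36 * (ι n - ι m) ≡ ι p * ℚof 30)
  (eqL : frac (+ 1) 2 - frac (+ 3) 4 * L * (ℚof 2 * ι n + 1ℚ) ≡ ι p * (- (frac (+ 1) 4 * L)))
  (L≡±1 : L ≡ 1ℚ ⊎ L ≡ - 1ℚ)
  (sign-n : sign (suc q) ≡ sign n) (sign-m : sign (suc q) ≡ sign m)
  where
  open Proportional p pp

  private
    p∤2 : ¬ p ∣ 2
    p∤2 = >⇒∤ (ℕₚ.<-trans (ℕₚ.n<1+n 2) 3<p)

    p∤4 : ¬ p ∣ 4
    p∤4 = _⋆_ {2} {2} p∤2 p∤2

    p∤6 : ¬ p ∣ 6
    p∤6 = _⋆_ {2} {3} p∤2 (>⇒∤ 3<p)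

    Dt : D t
    Dt = mkD InDt

    DL : D L
    DL = [ (λ { refl → D-lit 1 }) , (λ { refl → D-neg (D-lit 1) }) ]′ L≡±1

    I-zero : ∀ {x} → x ≡ 0ℚ → I x
    I-zero refl = subst I (ℚₚ.*-zeroʳ (ι p)) (I-p (D-lit 0))

    D-odd : ∀ k → D (φW k)
    D-odd k = D-+ (D-* (D-lit 2) (D-ι k)) (D-lit 1)

    I⇒mod : ∀ a b → I (a - b) → a ≡ b [mod p ]
    I⇒mod a b (mkI c Dc eq) = c , inD Dc , trans eq (cong (_* c) (ι≡ℚof p))

  module TW = Transfer p pp p∤2 p∤6 2 n m q r 1+n+m≡p 3+2q≡p n<q eqr eqr′

  private
    cW : ℚ
    cW = frac (+ 3) 4 * L

    D-cW : D cW
    D-cW = D-* (D-/ (+ 3) 4 p∤4) DL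

    D-e : D (- (frac (+ 1) 4 * L))
    D-e = D-neg (D-* (D-/ (+ 1) 4 p∤4) DL)

    S∼Wn : Rel cW (S 0) (W.b n 0)
    S∼Wn rewrite W.b-zero n = rel (D-odd n) (subst I (sym eqL) (I-p D-e))

    S∼Wm : Rel (cW * - 1ℚ) (S 0) (W.b m 0)
    S∼Wm rewrite W.b-zero m = rel (D-odd m) (subst I (sym eq) (I-p (D-+ D-e (D-* (D-lit 2) D-cW))))
      where
      -- As `2m + 1 = 2p - (2n + 1)`, passing from `n` to `m` with the opposite sign adds `2 cW` to
      -- the quotient in `eqL`.
      eq : frac (+ 1) 2 - cW * - 1ℚ * φW m ≡ ι p * (- (frac (+ 1) 4 * L) + ℚof 2 * cW)
      eq = begin
        frac (+ 1) 2 - cW * - 1ℚ * φW m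
          ≡⟨ solve 3 (λ c n m → con (frac (+ 1) 2) :- c :* con (- 1ℚ) :* (con (ℚof 2) :* m :+ con 1ℚ)
               := (con (frac (+ 1) 2) :- c :* (con (ℚof 2) :* n :+ con 1ℚ)) :+ (n :+ m :+ con 1ℚ) :* (con (ℚof 2) :* c))
                   refl cW (ι n) (ι m) ⟩
        (frac (+ 1) 2 - cW * φW n) + (ι n + ι m + 1ℚ) * (ℚof 2 * cW)
          ≡⟨ cong₂ (λ x y → x + y * (ℚof 2 * cW)) eqL TW.ιp≡ ⟩
        ι p * (- (frac (+ 1) 4 * L)) + ι p * (ℚof 2 * cW)
          ≡⟨ ℚₚ.*-distribˡ-+ (ι p) (- (frac (+ 1) 4 * L)) (ℚof 2 * cW) ⟨
        ι p * (- (frac (+ 1) 4 * L) + ℚof 2 * cW) ∎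

    Wm∼Wn : Rel (- 1ℚ) (W.b m 0) (W.b n 0)
    Wm∼Wn rewrite W.b-zero m | W.b-zero n = rel (D-odd n) (subst I (sym eq) (I-p (D-lit 2)))
      where
      eq : φW m - - 1ℚ * φW n ≡ ι p * ℚof 2
      eq = trans (solve 2 (λ n m → (con (ℚof 2) :* m :+ con 1ℚ) :- con (- 1ℚ) :* (con (ℚof 2) :* n :+ con 1ℚ)
          := (n :+ m :+ con 1ℚ) :* con (ℚof 2)) refl (ι n) (ι m))
        (cong (_* ℚof 2) TW.ιp≡)

    x y : ℚ
    x = 1ℚ - ℚof 216 * t
    y = ℚof 216 * t - 1ℚ

    x≡ : x ≡ 1ℚ * (1ℚ - ℚof 216 * t)
    x≡ = sym (ℚₚ.*-identityˡ x)

    y≡ : y ≡ - 1ℚ * (1ℚ - ℚof 216 * t)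
    y≡ = solve 1 (λ t → con (ℚof 216) :* t :- con 1ℚ := con (- 1ℚ) :* (con 1ℚ :- con (ℚof 216) :* t)) refl t

    n<1+q : n < suc q
    n<1+q = ℕₚ.m<n⇒m<1+n n<q

  claim₁ : Σ[ 0 , n ] (λ k → S k * t ^ k) ≡ cW * w n x [mod p ]
  claim₁ =
    I⇒mod (Σ[ 0 , n ] (λ k → S k * t ^ k)) (cW * w n x)
    (subst (λ z → I (Σ[ 0 , n ] (λ k → S k * t ^ k) - cW * z)) (sym (W.w≡F t x x≡ n (suc n) ℕₚ.≤-refl))
    (TW.sum-low D-cW (D-neg (D-lit 1)) S-rec (W.b-rec n) (W.b-rec m) (W.b-vanish n) S∼Wn S∼Wm Wm∼Wn t Dt))

  claim₂ : Σ[ suc q , m ] (λ k → S k * t ^ k) ≡ (- frac (+ 1) 8) * L * (w m x + w n x) [mod p ]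
  claim₂ =
    I⇒mod (Σ[ suc q , m ] (λ k → S k * t ^ k)) ((- frac (+ 1) 8) * L * (w m x + w n x))
    (subst (λ z → I (Σ[ suc q , m ] (λ k → S k * t ^ k) - z)) eq
    (TW.sum-high D-cW (D-neg (D-lit 1)) S-rec (W.b-rec n) (W.b-rec m) (W.b-vanish n) S∼Wn S∼Wm Wm∼Wn t Dt (ℕₚ.<⇒≤ q<m)))
    where
    -- The constant is `3/4 · (-1) · 1/6 = -1/8`; the plus sign between the polynomials is the
    -- effect of `σ = -1`.
    eq : cW * - 1ℚ * TW.1/6ℚ * (W.F t m (suc m) - - 1ℚ * W.F t n (suc q)) ≡ (- frac (+ 1) 8) * L * (w m x + w n x)
    eq = begin
      cW * - 1ℚ * TW.1/6ℚ * (W.F t m (suc m) - - 1ℚ * W.F t n (suc q))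
        ≡⟨ cong₂ (λ u v → cW * - 1ℚ * TW.1/6ℚ * (u - - 1ℚ * v)) (W.w≡F t x x≡ m (suc m) ℕₚ.≤-refl) (W.w≡F t x x≡ n (suc q) n<1+q) ⟨
      cW * - 1ℚ * TW.1/6ℚ * (w m x - - 1ℚ * w n x)
        ≡⟨ solve 3 (λ L u v → con (frac (+ 3) 4) :* L :* con (- 1ℚ) :* con (frac (+ 1) 6) :* (u :- con (- 1ℚ) :* v)
             := con (- frac (+ 1) 8) :* L :* (u :+ v)) refl L (w m x) (w n x) ⟩
      (- frac (+ 1) 8) * L * (w m x + w n x) ∎

  module TV = Transfer p pp p∤2 p∤6 0 n m (suc q) r 1+n+m≡p (trans (cong suc (ℕₚ.*-suc 2 q)) 3+2q≡p) n<1+q eqr eqr′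

  private
    -- `T 0` is `1/2`, and both polynomials have the constant coefficient `sign (suc q)`, which is
    -- its own inverse.
    cV : ℚ
    cV = frac (+ 1) 2 * sign (suc q)

    D-cV : D cV
    D-cV = D-* (D-/ (+ 1) 2 p∤2) (D-^ (D-neg (D-lit 1)) (suc q))

    V-zero : ∀ N → sign (suc q) ≡ sign N → V.b N 0 ≡ sign (suc q)
    V-zero N eq = trans (V.b-zero N) (sym eq)

    D-sign : D (sign (suc q))
    D-sign = D-^ (D-neg (D-lit 1)) (suc q)

    T0-eq : T 0 - cV * sign (suc q) ≡ 0ℚ
    T0-eq = begin
      frac (+ 1) 2 - frac (+ 1) 2 * s * s
        ≡⟨ solve 1 (λ s → con (frac (+ 1) 2) :- con (frac (+ 1) 2) :* s :* s
            := con (frac (+ 1) 2) :* (con 1ℚ :- s :* s)) refl s ⟩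
      frac (+ 1) 2 * (1ℚ - s * s)                ≡⟨ cong (λ z → frac (+ 1) 2 * (1ℚ - z)) (sign-square (suc q)) ⟩
      0ℚ                                         ∎
      where
      s : ℚ
      s = sign (suc q)

    T∼Vn : Rel cV (T 0) (V.b n 0)
    T∼Vn = subst (Rel cV (T 0)) (sym (V-zero n sign-n)) (rel D-sign (I-zero T0-eq))

    T∼Vm : Rel (cV * 1ℚ) (T 0) (V.b m 0)
    T∼Vm =
      subst₂ (λ c B → Rel c (T 0) B) (sym (ℚₚ.*-identityʳ cV)) (sym (V-zero m sign-m)) (rel D-sign (I-zero T0-eq))

    Vm∼Vn : Rel 1ℚ (V.b m 0) (V.b n 0)
    Vm∼Vn = subst₂ (Rel 1ℚ) (sym (V-zero m sign-m)) (sym (V-zero n sign-n))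
      (rel D-sign (I-zero (solve 1 (λ s → s :- con 1ℚ :* s := con 0ℚ) refl (sign (suc q)))))

  claim₃ : Σ[ 0 , n ] (λ k → T k * t ^ k) ≡ cV * w n y [mod p ]
  claim₃ =
    I⇒mod (Σ[ 0 , n ] (λ k → T k * t ^ k)) (cV * w n y)
    (subst (λ z → I (Σ[ 0 , n ] (λ k → T k * t ^ k) - cV * z)) (sym (V.w≡F t y y≡ n (suc n) ℕₚ.≤-refl))
    (TV.sum-low D-cV (D-lit 1) T-rec (V.b-rec n) (V.b-rec m) (V.b-vanish n) T∼Vn T∼Vm Vm∼Vn t Dt))

  claim₄ : Σ[ suc (suc q) , m ] (λ k → T k * t ^ k) ≡ frac (+ 1) 12 * sign (suc q) * (w m y - w n y) [mod p ]
  claim₄ =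
    I⇒mod (Σ[ suc (suc q) , m ] (λ k → T k * t ^ k)) (frac (+ 1) 12 * sign (suc q) * (w m y - w n y))
    (subst (λ z → I (Σ[ suc (suc q) , m ] (λ k → T k * t ^ k) - z)) eq
    (TV.sum-high D-cV (D-lit 1) T-rec (V.b-rec n) (V.b-rec m) (V.b-vanish n) T∼Vn T∼Vm Vm∼Vn t Dt q<m))
    where
    eq : cV * 1ℚ * TV.1/6ℚ * (V.F t m (suc m) - 1ℚ * V.F t n (suc (suc q))) ≡ frac (+ 1) 12 * sign (suc q) * (w m y - w n y)
    eq = begin
      cV * 1ℚ * TV.1/6ℚ * (V.F t m (suc m) - 1ℚ * V.F t n (suc (suc q)))
        ≡⟨ cong₂ (λ u v → cV * 1ℚ * TV.1/6ℚ * (u - 1ℚ * v)) (V.w≡F t y y≡ m (suc m) ℕₚ.≤-refl)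
             (V.w≡F t y y≡ n (suc (suc q)) (ℕₚ.m<n⇒m<1+n n<1+q)) ⟨
      cV * 1ℚ * TV.1/6ℚ * (w m y - 1ℚ * w n y)
        ≡⟨ solve 3 (λ s u v → con (frac (+ 1) 2) :* s :* con 1ℚ :* con (frac (+ 1) 6) :* (u :- con 1ℚ :* v)
             := con (frac (+ 1) 12) :* s :* (u :- v)) refl (sign (suc q)) (w m y) (w n y) ⟩
      frac (+ 1) 12 * sign (suc q) * (w m y - w n y) ∎

  claims : p / 6 ≡ n → (5 ℕ.* p) / 6 ≡ m → (p ∸ 1) / 2 ≡ suc q → (p ℕ.+ 1) / 2 ≡ suc (suc q) → legendre3 p ≡ L →
    Claims p t (p / 6) ((5 ℕ.* p) / 6) ((p ∸ 1) / 2) ((p ℕ.+ 1) / 2) (legendre3 p)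
  claims eqn eqm eqa eqb eqL = transport eqn eqm eqa eqb eqL (claim₁ , claim₂ , claim₃ , claim₄)
    where
    transport : ∀ {n n′ m m′ a a′ b b′ L L′} → n′ ≡ n → m′ ≡ m → a′ ≡ a → b′ ≡ b → L′ ≡ L →
      Claims p t n m a b L → Claims p t n′ m′ a′ b′ L′
    transport refl refl refl refl refl c = c

-- The residue classes 1 and 5 modulo 6

legendre3-residue : ∀ {p} r k → p ≡ r ℕ.+ k ℕ.* 3 → legendre3 p ≡ legendre3 r
legendre3-residue r k refl = cong legendre3-rem ([m+kn]%n≡m%n r k 3)

ι-linear′ : ∀ a c k → ι (c ℕ.+ k ℕ.* a) ≡ ℚof c + ℚof a * ι k
ι-linear′ a c k = trans (cong (λ x → ι (c ℕ.+ x)) (ℕₚ.*-comm k a)) (ι-linear a c k)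

-- With `N = suc n = ⌊p/6⌋` the prime is the factor `6N + 1`, and `r` is `6N + 5`.
claims-7+6n : ∀ p n → p ≡ 7 ℕ.+ n ℕ.* 6 → Prime p → 3 < p → ∀ t → InD p t →
  Claims p t (p / 6) ((5 ℕ.* p) / 6) ((p ∸ 1) / 2) ((p ℕ.+ 1) / 2) (legendre3 p)
claims-7+6n p n p≡ pp 3<p t InDt =
  let e₁ , e₂ , e₃ , e₄ , e₅ , e₆ = 7+6n-identities n; s₁ , s₂ , _ = sign-exponents n in
  Core.claims p pp 3<p t InDt (suc n) m q r 1ℚ (trans e₁ (sym p≡)) (trans e₂ (sym p≡)) n<q q<m eqr eqr′ eqL (inj₁ refl)
    (sign-even (suc n) s₁)
    (trans (sign-even (suc n) s₁) (sym (sign-even (2 ℕ.+ 2 ℕ.* n) s₂)))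
    (/-unique 1 (suc n) 6 (ℕₚ.m≤m+n 2 4) p≡)
    (/-unique 5 m 6 (ℕₚ.m≤m+n 6 0) (trans (cong (5 ℕ.*_) p≡) e₃))
    (/-unique 0 (suc q) 2 (ℕₚ.m≤m+n 1 1) (trans (cong (_∸ 1) p≡) e₄))
    (/-unique 0 (suc (suc q)) 2 (ℕₚ.m≤m+n 1 1) (trans (cong (ℕ._+ 1) p≡) e₅))
    (legendre3-residue 1 (2 ℕ.+ 2 ℕ.* n) (trans p≡ e₆))
  where
  m q r : ℕ
  m = 5 ℕ.+ 5 ℕ.* n
  q = 2 ℕ.+ 3 ℕ.* n
  r = 11 ℕ.+ 6 ℕ.* n
  ιp : ι p ≡ ℚof 7 + ℚof 6 * ι n
  ιp = trans (cong ι p≡) (ι-linear′ 6 7 n)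
  n<q : suc n < q
  n<q = s≤s (s≤s (ℕₚ.m≤m+n n (2 ℕ.* n)))
  q<m : q < m
  q<m = ℕₚ.+-mono-≤ (ℕₚ.m≤m+n 3 2) (ℕₚ.*-monoˡ-≤ n (ℕₚ.m≤m+n 3 2))
  eqr : (ℚof 6 * ι (suc n) + 1ℚ) * (ℚof 6 * ι (suc n) + ℚof 5) ≡ ι p * ι r
  eqr = trans (cong (λ z → (ℚof 6 * z + 1ℚ) * (ℚof 6 * z + ℚof 5)) (ι-suc n))
    (trans (solve 1 (λ n → (con (ℚof 6) :* (n :+ con 1ℚ) :+ con 1ℚ) :* (con (ℚof 6) :* (n :+ con 1ℚ) :+ con (ℚof 5))
        := (con (ℚof 7) :+ con (ℚof 6) :* n) :* (con (ℚof 11) :+ con (ℚof 6) :* n)) refl (ι n))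
      (sym (cong₂ _*_ ιp (ι-linear 6 11 n))))
  eqr′ : ℚof 6 * ι r - ℚof 36 * (ι (suc n) - ι m) ≡ ι p * ℚof 30
  eqr′ = begin
    ℚof 6 * ι r - ℚof 36 * (ι (suc n) - ι m)
      ≡⟨ cong₂ (λ x y → ℚof 6 * x - ℚof 36 * y) (ι-linear 6 11 n) (cong₂ _-_ (ι-suc n) (ι-linear 5 5 n)) ⟩
    ℚof 6 * (ℚof 11 + ℚof 6 * ι n) - ℚof 36 * ((ι n + 1ℚ) - (ℚof 5 + ℚof 5 * ι n))
      ≡⟨ solve 1 (λ n → con (ℚof 6) :* (con (ℚof 11) :+ con (ℚof 6) :* n) :- con (ℚof 36) :* ((n :+ con 1ℚ) :- (con (ℚof 5) :+ con (ℚof 5) :* n))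
           := (con (ℚof 7) :+ con (ℚof 6) :* n) :* con (ℚof 30)) refl (ι n) ⟩
    (ℚof 7 + ℚof 6 * ι n) * ℚof 30     ≡⟨ cong (_* ℚof 30) ιp ⟨
    ι p * ℚof 30 ∎
  eqL : frac (+ 1) 2 - frac (+ 3) 4 * 1ℚ * (ℚof 2 * ι (suc n) + 1ℚ) ≡ ι p * (- (frac (+ 1) 4 * 1ℚ))
  eqL = begin
    frac (+ 1) 2 - frac (+ 3) 4 * 1ℚ * (ℚof 2 * ι (suc n) + 1ℚ)
      ≡⟨ cong (λ z → frac (+ 1) 2 - frac (+ 3) 4 * 1ℚ * (ℚof 2 * z + 1ℚ)) (ι-suc n) ⟩
    frac (+ 1) 2 - frac (+ 3) 4 * 1ℚ * (ℚof 2 * (ι n + 1ℚ) + 1ℚ)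
      ≡⟨ solve 1 (λ n → con (frac (+ 1) 2) :- con (frac (+ 3) 4) :* con 1ℚ :* (con (ℚof 2) :* (n :+ con 1ℚ) :+ con 1ℚ)
           := (con (ℚof 7) :+ con (ℚof 6) :* n) :* (:- (con (frac (+ 1) 4) :* con 1ℚ))) refl (ι n) ⟩
    (ℚof 7 + ℚof 6 * ι n) * (- (frac (+ 1) 4 * 1ℚ))   ≡⟨ cong (_* (- (frac (+ 1) 4 * 1ℚ))) ιp ⟨
    ι p * (- (frac (+ 1) 4 * 1ℚ)) ∎

-- The roles are exchanged: `p` is the factor `6n + 5` and `r` is `6n + 1`.
claims-5+6n : ∀ p n → p ≡ 5 ℕ.+ n ℕ.* 6 → Prime p → 3 < p → ∀ t → InD p t →
  Claims p t (p / 6) ((5 ℕ.* p) / 6) ((p ∸ 1) / 2) ((p ℕ.+ 1) / 2) (legendre3 p)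
claims-5+6n p n p≡ pp 3<p t InDt =
  let e₁ , e₂ , e₃ , e₄ , e₅ , e₆ = 5+6n-identities n; _ , _ , s₁ , s₂ = sign-exponents n in
  Core.claims p pp 3<p t InDt n m q r (- 1ℚ) (trans e₁ (sym p≡)) (trans e₂ (sym p≡)) n<q q<m eqr eqr′ eqL (inj₂ refl)
    (sign-even (suc n) s₁)
    (trans (sign-even (suc n) s₁) (sym (sign-even (2 ℕ.+ 2 ℕ.* n) s₂)))
    (/-unique 5 n 6 (ℕₚ.m≤m+n 6 0) p≡)
    (/-unique 1 m 6 (ℕₚ.m≤m+n 2 4) (trans (cong (5 ℕ.*_) p≡) e₃))
    (/-unique 0 (suc q) 2 (ℕₚ.m≤m+n 1 1) (trans (cong (_∸ 1) p≡) e₄))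
    (/-unique 0 (suc (suc q)) 2 (ℕₚ.m≤m+n 1 1) (trans (cong (ℕ._+ 1) p≡) e₅))
    (legendre3-residue 2 (1 ℕ.+ 2 ℕ.* n) (trans p≡ e₆))
  where
  m q r : ℕ
  m = 4 ℕ.+ 5 ℕ.* n
  q = 1 ℕ.+ 3 ℕ.* n
  r = 1 ℕ.+ 6 ℕ.* n
  ιp : ι p ≡ ℚof 5 + ℚof 6 * ι n
  ιp = trans (cong ι p≡) (ι-linear′ 6 5 n)
  n<q : n < q
  n<q = s≤s (ℕₚ.m≤m+n n (2 ℕ.* n))
  q<m : q < m
  q<m = ℕₚ.+-mono-≤ (ℕₚ.m≤m+n 2 2) (ℕₚ.*-monoˡ-≤ n (ℕₚ.m≤m+n 3 2))
  eqr : (ℚof 6 * ι n + 1ℚ) * (ℚof 6 * ι n + ℚof 5) ≡ ι p * ι r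
  eqr = trans (solve 1 (λ n → (con (ℚof 6) :* n :+ con 1ℚ) :* (con (ℚof 6) :* n :+ con (ℚof 5))
      := (con (ℚof 5) :+ con (ℚof 6) :* n) :* (con (ℚof 1) :+ con (ℚof 6) :* n)) refl (ι n))
    (sym (cong₂ _*_ ιp (ι-linear 6 1 n)))
  eqr′ : ℚof 6 * ι r - ℚof 36 * (ι n - ι m) ≡ ι p * ℚof 30
  eqr′ = begin
    ℚof 6 * ι r - ℚof 36 * (ι n - ι m)
      ≡⟨ cong₂ (λ x y → ℚof 6 * x - ℚof 36 * (ι n - y)) (ι-linear 6 1 n) (ι-linear 5 4 n) ⟩
    ℚof 6 * (ℚof 1 + ℚof 6 * ι n) - ℚof 36 * (ι n - (ℚof 4 + ℚof 5 * ι n))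
      ≡⟨ solve 1 (λ n → con (ℚof 6) :* (con (ℚof 1) :+ con (ℚof 6) :* n) :- con (ℚof 36) :* (n :- (con (ℚof 4) :+ con (ℚof 5) :* n))
           := (con (ℚof 5) :+ con (ℚof 6) :* n) :* con (ℚof 30)) refl (ι n) ⟩
    (ℚof 5 + ℚof 6 * ι n) * ℚof 30     ≡⟨ cong (_* ℚof 30) ιp ⟨
    ι p * ℚof 30 ∎
  eqL : frac (+ 1) 2 - frac (+ 3) 4 * - 1ℚ * (ℚof 2 * ι n + 1ℚ) ≡ ι p * (- (frac (+ 1) 4 * - 1ℚ))
  eqL = begin
    frac (+ 1) 2 - frac (+ 3) 4 * - 1ℚ * (ℚof 2 * ι n + 1ℚ)
      ≡⟨ solve 1 (λ n → con (frac (+ 1) 2) :- con (frac (+ 3) 4) :* con (- 1ℚ) :* (con (ℚof 2) :* n :+ con 1ℚ)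
           := (con (ℚof 5) :+ con (ℚof 6) :* n) :* (:- (con (frac (+ 1) 4) :* con (- 1ℚ)))) refl (ι n) ⟩
    (ℚof 5 + ℚof 6 * ι n) * (- (frac (+ 1) 4 * - 1ℚ))   ≡⟨ cong (_* (- (frac (+ 1) 4 * - 1ℚ))) ιp ⟨
    ι p * (- (frac (+ 1) 4 * - 1ℚ)) ∎

theorem32 : (p : ℕ) → Prime p → 3 < p → (t : ℚ) → InD p t →
    (Σ[ 0 , p / 6 ] (λ k → S k * t ^ k)
    ≡ frac (+ 3) 4 * legendre3 p * w (p / 6) (1ℚ - ℚof 216 * t) [mod p ])
    × (Σ[ (p ∸ 1) / 2 , (5 ℕ.* p) / 6 ] (λ k → S k * t ^ k)
    ≡ (- frac (+ 1) 8) * legendre3 p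
    * (w ((5 ℕ.* p) / 6) (1ℚ - ℚof 216 * t) + w (p / 6) (1ℚ - ℚof 216 * t)) [mod p ])
    × (Σ[ 0 , p / 6 ] (λ k → ℚof (2 ℕ.* k ℕ.+ 1) * S k * t ^ k)
    ≡ frac (+ 1) 2 * (- 1ℚ) ^ ((p ∸ 1) / 2) * w (p / 6) (ℚof 216 * t - 1ℚ) [mod p ])
    × (Σ[ (p ℕ.+ 1) / 2 , (5 ℕ.* p) / 6 ] (λ k → ℚof (2 ℕ.* k ℕ.+ 1) * S k * t ^ k)
    ≡ frac (+ 1) 12 * (- 1ℚ) ^ ((p ∸ 1) / 2)
    * (w ((5 ℕ.* p) / 6) (ℚof 216 * t - 1ℚ) - w (p / 6) (ℚof 216 * t - 1ℚ)) [mod p ])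
theorem32 p pp 3<p t InDt =
  [ (λ { (n , p≡) → claims-7+6n p n p≡ pp 3<p t InDt }) , (λ { (n , p≡) → claims-5+6n p n p≡ pp 3<p t InDt }) ]′
    (residue-cases p pp 3<p (p % 6) (p / 6) (m%n<n p 6) (m≡m%n+[m/n]*n p 6))
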